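{- For all integers $a,m$ with $1\le a\le m-1$, the sequence $\{\mathrm{cp}_{a,m-a,m}(n)\}_{n=0}^\infty$ takes both even and odd values infinitely often.
   Context: For integers $a,b,m\ge1$, an $(a,b,m)$-copartition is a triple of integer partitions $(\gamma,\rho,\sigma)$ such that every part of $\gamma$ is $\ge a$ and $\equiv a \pmod m$, every part of $\sigma$ is $\ge b$ and $\equiv b\pmod m$, and $\rho$ has exactly as many parts as $\sigma$, each part of $\rho$ being equal to $m$ times the number of parts of $\gamma$. Its size is the sum of all parts of $\gamma,\rho,\sigma$, and $\mathrm{cp}_{a,b,m}(n)$ denotes the number of $(a,b,m)$-copartitions of size $n$. -}

module Defs where

open import Data.Nat using (ℕ; zero; suc; _+_; _*_; _∸_; _≤?_; _⊓_; _≡ᵇ_)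
open import Data.Nat.Divisibility using (_∣?_)
open import Data.Bool using (Bool; true; false; _∧_)
open import Data.List using (List; []; _∷_; map; concatMap; length; filter; upTo; replicate)
open import Data.Bool.ListAction using (and)
open import Data.Nat.ListAction using (sum)
open import Data.Product using (_×_; _,_; proj₁; proj₂)
open import Relation.Nullary.Decidable using (⌊_⌋)
open import Relation.Binary.PropositionalEquality using (_≡_)

-- Integer partitions are represented as weakly decreasing lists of
-- positive integers.  partitionsBounded f n b lists all partitions of n
-- with every part ≤ b (f is recursion fuel, f ≥ n suffices).
partitionsBounded : ℕ → ℕ → ℕ → List (List ℕ)
partitionsBounded _ zero _ = [] ∷ []
partitionsBounded zero (suc n) _ = []
partitionsBounded (suc f) (suc n) b =
  concatMap (λ i → map (suc i ∷_) (partitionsBounded f (suc n ∸ suc i) (suc i)))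
            (upTo (suc n ⊓ b))

partitions : ℕ → List (List ℕ)
partitions n = partitionsBounded n n n

goodPart : ℕ → ℕ → ℕ → Bool
goodPart r m x = ⌊ r ≤? x ⌋ ∧ ⌊ m ∣? (x ∸ r) ⌋

Triple : Set
Triple = List ℕ × List ℕ × List ℕ

size : Triple → ℕ
size (γ , ρ , σ) = sum γ + sum ρ + sum σ

copartitions : ℕ → ℕ → ℕ → ℕ → List Triple
copartitions a b m n =
  filter (λ t → size t Data.Nat.≟ n)
    (concatMap (λ i → concatMap (λ k →
        concatMap (λ γ → map (λ σ → (γ , replicate (length σ) (m * length γ) , σ))
                              (filter (λ σ → and (map (goodPart b m) σ) Data.Bool.≟ true) (partitions k)))
                  (filter (λ γ → and (map (goodPart a m) γ) Data.Bool.≟ true) (partitions i)))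
      (upTo (suc n)))
      (upTo (suc n)))

cp : ℕ → ℕ → ℕ → ℕ → ℕ
cp a b m n = length (copartitions a b m n)

{-# OPTIONS --safe #-}

-- Work with power series over F₂. Let F be the generating function of cp a b m, b = m - a, and let
-- T_j = a j + m j (j - 1) / 2 for j ∈ ℤ. A copartition with r and s parts in γ and σ has weight
-- q^(a r + b s + m r s) / ((q^m; q^m)_r (q^m; q^m)_s), and substituting j = k - r + s in F · ∑_j q^(T_j) splits the
-- exponent into a part depending on r and k and a part depending on s and k. For k ≠ 0 one of the two resulting
-- sums is ∏_{i ≥ 1} (1 + q^(m (i - |k|))), which vanishes because of its factor 1 + 1. Hence only k = 0 survives
-- and the product is supported on multiples of m.
-- The gaps between consecutive T_j grow without bound. At an exponent n not divisible by m, the sum of F (n - T_j)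
-- therefore has an odd number of terms, all with large arguments, if n lies far beyond a suitable T_j (so they
-- cannot all be 1), and it contains F 0 = 1 besides terms with large arguments if n is itself a suitable T_j (so
-- these cannot all be 0).
-- The second choice needs a ≠ b. If a = b, exchanging γ and σ shows that cp a a m (2 m n) has the parity of the
-- number of partitions of n into distinct parts, which is odd at pentagonal numbers.
module Submission where

open import Defs
open import Algebra.Bundles using (CommutativeMonoid; CommutativeRing)
import Algebra.Properties.CommutativeSemigroup as CommutativeSemigroupProperties
open import Data.Bool as Bool using (Bool; true; false; _∧_; _xor_; not)
open import Data.Bool.ListAction using (and)
open import Data.Bool.Properties
  using (xor-assoc; xor-comm; xor-same; xor-identityʳ; xor-∧-commutativeRing; ∧-distribˡ-xor; ∧-distribʳ-xor;
         ∧-zeroʳ; ∧-comm; ∧-assoc; ∧-idem; ∧-identityʳ; ∧-commutativeMonoid; not-involutive; ¬-not; ⇔→≡)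
open import Data.Integer as ℤ using (ℤ; +_; -[1+_]; _+_; _-_; _*_; -_; _⊖_; ∣_∣)
import Data.Integer.Properties as ℤ
open import Data.Integer.Tactic.RingSolver using (solve-∀)
open import Data.List using (List; []; _∷_; _++_; map; concatMap; length; filter; upTo; applyUpTo; replicate)
open import Data.List.Relation.Unary.All as All using (All; []; _∷_)
import Data.List.Relation.Unary.All.Properties as All
open import Data.Nat as ℕ using (ℕ; zero; suc; _<_; _≤_; _∸_; z≤n; s≤s; _⊓_; _≡ᵇ_)
open import Data.Nat.Divisibility as ∣ using (_∣_; divides; _∣?_)
open import Data.Nat.ListAction using (sum)
import Data.Nat.Properties as ℕ
open import Data.Product using (_×_; _,_; proj₁; proj₂; ∃-syntax)
open import Data.Sum using (_⊎_; inj₁; inj₂)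
open import Function using (_∘_; id; mk⇔)
open import Relation.Binary.Definitions using (tri<; tri≈; tri>)
open import Relation.Binary.PropositionalEquality
open import Relation.Nullary using (¬_; contradiction; does; yes; no; Dec)
open import Relation.Nullary.Decidable using (dec-true; dec-false)
open import Relation.Unary using (Decidable)

private
  open module ⊕-Properties = CommutativeSemigroupProperties
    (CommutativeMonoid.commutativeSemigroup (CommutativeRing.+-commutativeMonoid xor-∧-commutativeRing))
    using () renaming (interchange to xor-interchange)
  open module ∧-Properties = CommutativeSemigroupProperties
    (CommutativeMonoid.commutativeSemigroup ∧-commutativeMonoid)
    using () renaming (x∙yz≈y∙xz to ∧-left-comm)

-- Finite sums over the field with two elements.

xsum : ℕ → (ℕ → Bool) → Bool
xsum zero    f = false
xsum (suc n) f = f 0 xor xsum n (f ∘ suc)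

xsum-cong : ∀ n {f g : ℕ → Bool} → (∀ i → i < n → f i ≡ g i) → xsum n f ≡ xsum n g
xsum-cong zero    f≗g = refl
xsum-cong (suc n) f≗g = cong₂ _xor_ (f≗g 0 (s≤s z≤n)) (xsum-cong n (λ i i<n → f≗g (suc i) (s≤s i<n)))

xsum-false : ∀ n {f : ℕ → Bool} → (∀ i → i < n → f i ≡ false) → xsum n f ≡ false
xsum-false zero    f≗0 = refl
xsum-false (suc n) f≗0 rewrite f≗0 0 (s≤s z≤n) = xsum-false n (λ i i<n → f≗0 (suc i) (s≤s i<n))

xsum-xor : ∀ n (f g : ℕ → Bool) → xsum n (λ i → f i xor g i) ≡ xsum n f xor xsum n g
xsum-xor zero    f g = refl
xsum-xor (suc n) f g = trans (cong ((f 0 xor g 0) xor_) (xsum-xor n (f ∘ suc) (g ∘ suc)))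
                             (xor-interchange (f 0) (g 0) _ _)

xsum-last : ∀ n (f : ℕ → Bool) → xsum (suc n) f ≡ xsum n f xor f n
xsum-last zero    f = xor-comm (f 0) false
xsum-last (suc n) f = trans (cong (f 0 xor_) (xsum-last n (f ∘ suc))) (sym (xor-assoc (f 0) _ _))

xsum-swap : ∀ m n (f : ℕ → ℕ → Bool) →
  xsum m (λ i → xsum n (f i)) ≡ xsum n (λ j → xsum m (λ i → f i j))
xsum-swap zero    n f = sym (xsum-false n (λ _ _ → refl))
xsum-swap (suc m) n f = trans (cong (xsum n (f 0) xor_) (xsum-swap m n (f ∘ suc)))
                              (sym (xsum-xor n (f 0) _))

∧-xsum : ∀ c n (f : ℕ → Bool) → c ∧ xsum n f ≡ xsum n (λ i → c ∧ f i)
∧-xsum c zero    f = ∧-zeroʳ c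
∧-xsum c (suc n) f = trans (∧-distribˡ-xor c (f 0) _) (cong ((c ∧ f 0) xor_) (∧-xsum c n (f ∘ suc)))

xsum-extend : ∀ m n (f : ℕ → Bool) → (∀ i → m ≤ i → f i ≡ false) → xsum (m ℕ.+ n) f ≡ xsum m f
xsum-extend zero    n f f≗0 = xsum-false n (λ i _ → f≗0 i z≤n)
xsum-extend (suc m) n f f≗0 = cong (f 0 xor_) (xsum-extend m n (f ∘ suc) (λ i m≤i → f≗0 (suc i) (s≤s m≤i)))

xsum-single : ∀ n {f : ℕ → Bool} j → j < n → (∀ i → i < n → ¬ i ≡ j → f i ≡ false) → xsum n f ≡ f j
xsum-single (suc n) {f} zero    _         f≗0 =
  trans (cong (f 0 xor_) (xsum-false n (λ i i<n → f≗0 (suc i) (s≤s i<n) (λ ())))) (xor-identityʳ (f 0))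
xsum-single (suc n) {f} (suc j) (s≤s j<n) f≗0 rewrite f≗0 0 (s≤s z≤n) (λ ()) =
  xsum-single n j j<n (λ i i<n i≢j → f≗0 (suc i) (s≤s i<n) (λ { refl → i≢j refl }))

-- Off the diagonal the entries at (i, j) and (j, i) cancel in characteristic 2.
xsum-diagonal : ∀ n (f : ℕ → ℕ → Bool) → (∀ i j → f i j ≡ f j i) →
  xsum n (λ i → xsum n (f i)) ≡ xsum n (λ i → f i i)
xsum-diagonal zero    f f-sym = refl
xsum-diagonal (suc n) f f-sym = begin
  (f 0 0 xor row) xor xsum n (λ i → f (suc i) 0 xor xsum n (λ j → f (suc i) (suc j)))
    ≡⟨ cong ((f 0 0 xor row) xor_) (xsum-xor n _ _) ⟩
  (f 0 0 xor row) xor (xsum n (λ i → f (suc i) 0) xor inner)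
    ≡⟨ cong (λ z → (f 0 0 xor row) xor (z xor inner)) (xsum-cong n (λ i _ → f-sym (suc i) 0)) ⟩
  (f 0 0 xor row) xor (row xor inner)
    ≡⟨ xor-assoc (f 0 0) row _ ⟩
  f 0 0 xor (row xor (row xor inner))
    ≡⟨ cong (f 0 0 xor_) (sym (xor-assoc row row inner)) ⟩
  f 0 0 xor ((row xor row) xor inner)
    ≡⟨ cong (λ z → f 0 0 xor (z xor inner)) (xor-same row) ⟩
  f 0 0 xor inner
    ≡⟨ cong (f 0 0 xor_) (xsum-diagonal n (λ i j → f (suc i) (suc j)) (λ i j → f-sym (suc i) (suc j))) ⟩
  f 0 0 xor xsum n (λ i → f (suc i) (suc i)) ∎
  where
  open ≡-Reasoning
  row = xsum n (λ j → f 0 (suc j))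
  inner = xsum n (λ i → xsum n (λ j → f (suc i) (suc j)))

-- Parities of list lengths as sums over F₂.

private variable
  S T : Set

parity : ℕ → Bool
parity zero    = false
parity (suc n) = not (parity n)

lsum : List S → (S → Bool) → Bool
lsum []       f = false
lsum (x ∷ xs) f = f x xor lsum xs f

lsum-cong : {f g : S → Bool} (xs : List S) → All (λ x → f x ≡ g x) xs → lsum xs f ≡ lsum xs g
lsum-cong []       []         = refl
lsum-cong (x ∷ xs) (eq ∷ eqs) = cong₂ _xor_ eq (lsum-cong xs eqs)

lsum-++ : (xs ys : List S) (f : S → Bool) → lsum (xs ++ ys) f ≡ lsum xs f xor lsum ys f
lsum-++ []       ys f = refl
lsum-++ (x ∷ xs) ys f = trans (cong (f x xor_) (lsum-++ xs ys f)) (sym (xor-assoc (f x) _ _))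

lsum-map : (g : S → T) (xs : List S) (f : T → Bool) → lsum (map g xs) f ≡ lsum xs (f ∘ g)
lsum-map g []       f = refl
lsum-map g (x ∷ xs) f = cong (f (g x) xor_) (lsum-map g xs f)

lsum-concatMap : (g : S → List T) (xs : List S) (f : T → Bool) →
  lsum (concatMap g xs) f ≡ lsum xs (λ x → lsum (g x) f)
lsum-concatMap g []       f = refl
lsum-concatMap g (x ∷ xs) f = trans (lsum-++ (g x) _ f) (cong (lsum (g x) f xor_) (lsum-concatMap g xs f))

lsum-filter : {P : S → Set} (P? : Decidable P) (xs : List S) (f : S → Bool) →
  lsum (filter P? xs) f ≡ lsum xs (λ x → does (P? x) ∧ f x)
lsum-filter P? []       f = refl
lsum-filter P? (x ∷ xs) f with does (P? x)
... | true  = cong (f x xor_) (lsum-filter P? xs f)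
... | false = lsum-filter P? xs f

lsum-applyUpTo : (g : ℕ → S) (n : ℕ) (f : S → Bool) → lsum (applyUpTo g n) f ≡ xsum n (f ∘ g)
lsum-applyUpTo g zero    f = refl
lsum-applyUpTo g (suc n) f = cong (f (g 0) xor_) (lsum-applyUpTo (g ∘ suc) n f)

lsum-concatMap-upTo : (g : ℕ → List S) (n : ℕ) (f : S → Bool) →
  lsum (concatMap g (upTo n)) f ≡ xsum n (λ i → lsum (g i) f)
lsum-concatMap-upTo g n f =
  trans (lsum-concatMap g (upTo n) f) (lsum-applyUpTo id n (λ i → lsum (g i) f))

parity-length-filter : {P : S → Set} (P? : Decidable P) (xs : List S) →
  parity (length (filter P? xs)) ≡ lsum xs (λ x → does (P? x))
parity-length-filter P? []       = refl
parity-length-filter P? (x ∷ xs) with does (P? x)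
... | true  = cong not (parity-length-filter P? xs)
... | false = parity-length-filter P? xs

lsum-xsum : (xs : List S) (n : ℕ) (f : S → ℕ → Bool) →
  lsum xs (λ x → xsum n (f x)) ≡ xsum n (λ i → lsum xs (λ x → f x i))
lsum-xsum []       n f = sym (xsum-false n (λ _ _ → refl))
lsum-xsum (x ∷ xs) n f = trans (cong (xsum n (f x) xor_) (lsum-xsum xs n f)) (sym (xsum-xor n (f x) _))

lsum-∧ : (xs : List S) (f : S → Bool) (c : Bool) → lsum xs (λ x → f x ∧ c) ≡ lsum xs f ∧ c
lsum-∧ []       f c = refl
lsum-∧ (x ∷ xs) f c = trans (cong ((f x ∧ c) xor_) (lsum-∧ xs f c)) (sym (∧-distribʳ-xor c (f x) _))

does-≟true : ∀ b → does (b Bool.≟ true) ≡ b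
does-≟true true  = refl
does-≟true false = refl

-- Partitions counted modulo 2 by size and number of parts, with integer sizes so that subtraction
-- never truncates.

δ : ℤ → Bool
δ (+ zero) = true
δ _        = false

allGood : (ℕ → Bool) → List ℕ → Bool
allGood g l = and (map g l)

-- The parity of the number of partitions of x into r parts which are at most b and satisfy g.
K : (ℕ → Bool) → ℕ → ℕ → ℤ → Bool
K g b       zero    x = δ x
K g zero    (suc r) x = false
K g (suc b) (suc r) x = K g b (suc r) x xor (g (suc b) ∧ K g (suc b) r (x - + suc b))

module _ (g : ℕ → Bool) where

  K-neg : ∀ b r n → K g b r -[1+ n ] ≡ false
  K-neg b       zero    n = refl
  K-neg zero    (suc r) n = refl
  K-neg (suc b) (suc r) n rewrite K-neg b (suc r) n | K-neg (suc b) r (suc (n ℕ.+ b)) = ∧-zeroʳ (g (suc b))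

  K-⊖ : ∀ b r {m n} → m < n → K g b r (m ⊖ n) ≡ false
  K-⊖ b r {m} {n} m<n = trans (cong (K g b r) (ℤ.⊖-< m<n)) (neg (n ∸ m) (ℕ.m<n⇒0<n∸m m<n))
    where
    neg : ∀ d → 0 < d → K g b r (- + d) ≡ false
    neg (suc d) _ = K-neg b r d

  K-zero : ∀ b r → K g b (suc r) (+ 0) ≡ false
  K-zero zero    r = refl
  K-zero (suc b) r rewrite K-zero b r | K-neg (suc b) r b = ∧-zeroʳ (g (suc b))

  -- The sum runs over the largest part `suc i`, which is how `partitionsBounded` generates its
  -- lists.
  K-unroll : ∀ b r x → K g b (suc r) x ≡ xsum b (λ i → g (suc i) ∧ K g (suc i) r (x - + suc i))
  K-unroll zero    r x = refl
  K-unroll (suc b) r x = trans (cong (_xor (g (suc b) ∧ K g (suc b) r (x - + suc b))) (K-unroll b r x))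
                               (sym (xsum-last b _))

  xsum-⊓ : ∀ n b f → (∀ i → n ≤ i → f i ≡ false) → xsum (n ⊓ b) f ≡ xsum b f
  xsum-⊓ n b f f≗0 with ℕ.≤-total n b
  ... | inj₁ n≤b = trans (cong (λ z → xsum z f) (ℕ.m≤n⇒m⊓n≡m n≤b))
                         (trans (sym (xsum-extend n (b ∸ n) f f≗0)) (cong (λ z → xsum z f) (ℕ.m+[n∸m]≡n n≤b)))
  ... | inj₂ b≤n = cong (λ z → xsum z f) (ℕ.m≥n⇒m⊓n≡n b≤n)

  -- Induction on the fuel, splitting by the largest part on both sides. The lists use largest parts
  -- up to `suc n ⊓ b` and `K-unroll` those up to b; the surplus terms have a negative remaining
  -- size and vanish.
  lsum-partitionsBounded : ∀ f n b r → n ≤ f →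
    lsum (partitionsBounded f n b) (λ l → allGood g l ∧ (length l ≡ᵇ r)) ≡ K g b r (+ n)
  lsum-partitionsBounded f       zero    b zero    _ = refl
  lsum-partitionsBounded f       zero    b (suc r) _ = sym (K-zero b r)
  lsum-partitionsBounded (suc f) (suc n) b r (s≤s n≤f) = begin
    lsum (concatMap parts (upTo (suc n ⊓ b))) test
      ≡⟨ lsum-concatMap parts (upTo (suc n ⊓ b)) test ⟩
    lsum (upTo (suc n ⊓ b)) (λ i → lsum (parts i) test)
      ≡⟨ lsum-applyUpTo id (suc n ⊓ b) _ ⟩
    xsum (suc n ⊓ b) (λ i → lsum (parts i) test)
      ≡⟨ xsum-cong (suc n ⊓ b) (λ i i< → trans (lsum-map (suc i ∷_) (rest i) test) (tails r i (ℕ.m<n⊓o⇒m<n (suc n) b i<))) ⟩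
    xsum (suc n ⊓ b) (summand r)
      ≡⟨ collect r ⟩
    K g b r (+ suc n) ∎
    where
    open ≡-Reasoning
    rest : ℕ → List (List ℕ)
    rest i = partitionsBounded f (n ∸ i) (suc i)
    parts : ℕ → List (List ℕ)
    parts i = map (suc i ∷_) (rest i)
    test : List ℕ → Bool
    test l = allGood g l ∧ (length l ≡ᵇ r)
    summand : ℕ → ℕ → Bool
    summand zero    i = false
    summand (suc r) i = g (suc i) ∧ K g (suc i) r (+ suc n - + suc i)
    tails : ∀ r i → i < suc n →
      lsum (rest i) (λ l → allGood g (suc i ∷ l) ∧ (suc (length l) ≡ᵇ r)) ≡ summand r i
    tails zero    i i≤n = trans (lsum-∧ (rest i) _ false) (∧-zeroʳ _)
    tails (suc r) i (s≤s i≤n) = begin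
      lsum (rest i) (λ l → (g (suc i) ∧ allGood g l) ∧ (length l ≡ᵇ r))
        ≡⟨ lsum-cong (rest i) (All.universal (λ l → trans (∧-assoc (g (suc i)) _ _) (∧-comm (g (suc i)) _)) (rest i)) ⟩
      lsum (rest i) (λ l → (allGood g l ∧ (length l ≡ᵇ r)) ∧ g (suc i))
        ≡⟨ lsum-∧ (rest i) _ (g (suc i)) ⟩
      lsum (rest i) (λ l → allGood g l ∧ (length l ≡ᵇ r)) ∧ g (suc i)
        ≡⟨ cong (_∧ g (suc i)) (lsum-partitionsBounded f (n ∸ i) (suc i) r (ℕ.≤-trans (ℕ.m∸n≤m n i) n≤f)) ⟩
      K g (suc i) r (+ (n ∸ i)) ∧ g (suc i)
        ≡⟨ ∧-comm _ (g (suc i)) ⟩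
      g (suc i) ∧ K g (suc i) r (+ (n ∸ i))
        ≡⟨ cong (λ z → g (suc i) ∧ K g (suc i) r z) (sym (trans (ℤ.[1+m]⊖[1+n]≡m⊖n n i) (ℤ.⊖-≥ i≤n))) ⟩
      summand (suc r) i ∎
    collect : ∀ r → xsum (suc n ⊓ b) (summand r) ≡ K g b r (+ suc n)
    collect zero    = xsum-false (suc n ⊓ b) (λ _ _ → refl)
    collect (suc r) = trans
      (xsum-⊓ (suc n) b (summand (suc r))
        (λ i n<i → trans (cong (g (suc i) ∧_) (K-⊖ (suc i) r (s≤s n<i))) (∧-zeroʳ _)))
      (sym (K-unroll b r (+ suc n)))

-- All parts are positive, whence the bound on the length; it lets sums over the number of parts be
-- cut off at any R > n.
partitionsBounded-sound : ∀ f n b → All (λ l → sum l ≡ n × length l ≤ n) (partitionsBounded f n b)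
partitionsBounded-sound f       zero    b = (refl , z≤n) ∷ []
partitionsBounded-sound zero    (suc n) b = []
partitionsBounded-sound (suc f) (suc n) b =
  All.concat⁺ (All.map⁺ (All.applyUpTo⁺₁ id (suc n ⊓ b) (λ {i} i< →
    All.map⁺ (All.map (λ {l} → step {l} (ℕ.≤-pred (ℕ.m<n⊓o⇒m<n (suc n) b i<))) (partitionsBounded-sound f (n ∸ i) (suc i))))))
  where
  step : ∀ {l i} → i ≤ n → sum l ≡ n ∸ i × length l ≤ n ∸ i →
    sum (suc i ∷ l) ≡ suc n × length (suc i ∷ l) ≤ suc n
  step {l} {i} i≤n (s , len) = trans (cong (suc i ℕ.+_) s) (cong suc (ℕ.m+[n∸m]≡n i≤n)) ,
                           s≤s (ℕ.≤-trans len (ℕ.m∸n≤m n i))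

sum-replicate : ∀ n x → sum (replicate n x) ≡ n ℕ.* x
sum-replicate zero    x = refl
sum-replicate (suc n) x = cong (x ℕ.+_) (sum-replicate n x)

lsum-partitions-by-length : ∀ g n R (h : ℕ → Bool) → n < R →
  lsum (partitions n) (λ l → allGood g l ∧ h (length l)) ≡ xsum R (λ r → K g n r (+ n) ∧ h r)
lsum-partitions-by-length g n R h n<R = begin
  lsum (partitions n) (λ l → allGood g l ∧ h (length l))
    ≡⟨ lsum-cong (partitions n) (All.map (λ {l} p → split l (proj₂ p)) (partitionsBounded-sound n n n)) ⟩
  lsum (partitions n) (λ l → xsum R (λ r → (allGood g l ∧ (length l ≡ᵇ r)) ∧ h r))
    ≡⟨ lsum-xsum (partitions n) R _ ⟩
  xsum R (λ r → lsum (partitions n) (λ l → (allGood g l ∧ (length l ≡ᵇ r)) ∧ h r))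
    ≡⟨ xsum-cong R (λ r _ → trans (lsum-∧ (partitions n) _ (h r)) (cong (_∧ h r) (lsum-partitionsBounded g n n n r ℕ.≤-refl))) ⟩
  xsum R (λ r → K g n r (+ n) ∧ h r) ∎
  where
  open ≡-Reasoning
  split : ∀ l → length l ≤ n → allGood g l ∧ h (length l) ≡ xsum R (λ r → (allGood g l ∧ (length l ≡ᵇ r)) ∧ h r)
  split l len = sym (trans
    (xsum-single R (length l) (ℕ.≤-<-trans len n<R)
      (λ r _ r≢ → cong (_∧ h r) (trans (cong (allGood g l ∧_) (dec-false (length l ℕ.≟ r) (r≢ ∘ sym))) (∧-zeroʳ _))))
    (cong (_∧ h (length l)) (trans (cong (allGood g l ∧_) (dec-true (length l ℕ.≟ length l) refl)) (∧-identityʳ _))))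

δ-≢ : ∀ x → ¬ x ≡ + 0 → δ x ≡ false
δ-≢ (+ zero)  x≢0 = contradiction refl x≢0
δ-≢ (+ suc x) x≢0 = refl
δ-≢ -[1+ x ]  x≢0 = refl

≡ᵇ-δ : ∀ m n → (m ≡ᵇ n) ≡ δ (+ n - + m)
≡ᵇ-δ m n = go (m ℕ.≟ n)
  where
  go : Dec (m ≡ n) → (m ≡ᵇ n) ≡ δ (+ n - + m)
  go (yes refl) = trans (dec-true (m ℕ.≟ m) refl) (sym (cong δ (ℤ.+-inverseʳ (+ m))))
  go (no m≢n)   = trans (dec-false (m ℕ.≟ n) m≢n)
    (sym (δ-≢ (+ n - + m) (λ eq → m≢n (sym (ℤ.+-injective (ℤ.i-j≡0⇒i≡j (+ n) (+ m) eq))))))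

-- The indices are the size i and length r of γ and the size k and length s of σ; ρ then consists of
-- s parts m r, and `δ` tests the total size. The cut-off R is left free because one R must later
-- serve many values of n.
parity-cp : ∀ a b m n R → n < R → parity (cp a b m n) ≡
  xsum (suc n) (λ i → xsum (suc n) (λ k → xsum R (λ r → K (goodPart a m) i r (+ i) ∧
    xsum R (λ s → K (goodPart b m) k s (+ k) ∧ δ (+ n - + i - + m * + r * + s - + k)))))
parity-cp a b m n R n<R = begin
  parity (cp a b m n)
    ≡⟨ parity-length-filter (λ t → size t ℕ.≟ n) (concatMap byI (upTo (suc n))) ⟩
  lsum (concatMap byI (upTo (suc n))) hit
    ≡⟨ lsum-concatMap-upTo byI (suc n) hit ⟩
  xsum (suc n) (λ i → lsum (byI i) hit)
    ≡⟨ xsum-cong (suc n) (λ i i≤n → trans (lsum-concatMap-upTo (byIK i) (suc n) hit)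
         (xsum-cong (suc n) (λ k k≤n → inner i k i≤n k≤n))) ⟩
  xsum (suc n) (λ i → xsum (suc n) (λ k → xsum R (λ r → K ga i r (+ i) ∧
    xsum R (λ s → K gb k s (+ k) ∧ total i k r s)))) ∎
  where
  open ≡-Reasoning
  ga = goodPart a m
  gb = goodPart b m
  good? : (g : ℕ → Bool) → Decidable (λ l → allGood g l ≡ true)
  good? g l = allGood g l Bool.≟ true
  triple : List ℕ → List ℕ → Triple
  triple γ σ = γ , replicate (length σ) (m ℕ.* length γ) , σ
  triples : ℕ → List ℕ → List Triple
  triples k γ = map (triple γ) (filter (good? gb) (partitions k))
  byIK : ℕ → ℕ → List Triple
  byIK i k = concatMap (triples k) (filter (good? ga) (partitions i))
  byI : ℕ → List Triple
  byI i = concatMap (byIK i) (upTo (suc n))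
  hit : Triple → Bool
  hit t = does (size t ℕ.≟ n)
  total : ℕ → ℕ → ℕ → ℕ → Bool
  total i k r s = δ (+ n - + i - + m * + r * + s - + k)
  arith : ∀ n i k m r s → n - (i + s * (m * r) + k) ≡ n - i - m * r * s - k
  arith = solve-∀
  hit-total : ∀ i k γ σ → sum γ ≡ i → sum σ ≡ k → hit (triple γ σ) ≡ total i k (length γ) (length σ)
  hit-total i k γ σ refl refl = trans (≡ᵇ-δ (size (triple γ σ)) n) (cong δ eq)
    where
    r = length γ
    s = length σ
    eq : + n - + (sum γ ℕ.+ sum (replicate s (m ℕ.* r)) ℕ.+ sum σ) ≡ + n - + sum γ - + m * + r * + s - + sum σ
    eq = trans (cong (λ z → + n - (+ sum γ + z + + sum σ))
                 (trans (cong +_ (sum-replicate s (m ℕ.* r)))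
                 (trans (ℤ.pos-* s (m ℕ.* r)) (cong (+ s *_) (ℤ.pos-* m r)))))
               (arith (+ n) (+ sum γ) (+ sum σ) (+ m) (+ r) (+ s))
  inner : ∀ i k → i < suc n → k < suc n → lsum (byIK i k) hit ≡
    xsum R (λ r → K ga i r (+ i) ∧ xsum R (λ s → K gb k s (+ k) ∧ total i k r s))
  inner i k i≤n k≤n = begin
    lsum (byIK i k) hit
      ≡⟨ lsum-concatMap (triples k) (filter (good? ga) (partitions i)) hit ⟩
    lsum (filter (good? ga) (partitions i)) (λ γ → lsum (triples k γ) hit)
      ≡⟨ lsum-filter (good? ga) (partitions i) (λ γ → lsum (triples k γ) hit) ⟩
    lsum (partitions i) (λ γ → does (good? ga γ) ∧ lsum (triples k γ) hit)
      ≡⟨ lsum-cong (partitions i) (All.map (λ {γ} p → cong₂ _∧_ (does-≟true (allGood ga γ)) (innerσ γ (proj₁ p)))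
           (partitionsBounded-sound i i i)) ⟩
    lsum (partitions i) (λ γ → allGood ga γ ∧ byLength (length γ))
      ≡⟨ lsum-partitions-by-length ga i R byLength (ℕ.<-≤-trans i≤n n<R) ⟩
    xsum R (λ r → K ga i r (+ i) ∧ byLength r) ∎
    where
    byLength : ℕ → Bool
    byLength r = xsum R (λ s → K gb k s (+ k) ∧ total i k r s)
    innerσ : ∀ γ → sum γ ≡ i → lsum (triples k γ) hit ≡ byLength (length γ)
    innerσ γ sumγ = begin
      lsum (triples k γ) hit
        ≡⟨ lsum-map (triple γ) (filter (good? gb) (partitions k)) hit ⟩
      lsum (filter (good? gb) (partitions k)) (λ σ → hit (triple γ σ))
        ≡⟨ lsum-filter (good? gb) (partitions k) (λ σ → hit (triple γ σ)) ⟩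
      lsum (partitions k) (λ σ → does (good? gb σ) ∧ hit (triple γ σ))
        ≡⟨ lsum-cong (partitions k) (All.map (λ {σ} p → cong₂ _∧_ (does-≟true (allGood gb σ)) (hit-total i k γ σ sumγ (proj₁ p)))
             (partitionsBounded-sound k k k)) ⟩
      lsum (partitions k) (λ σ → allGood gb σ ∧ total i k (length γ) (length σ))
        ≡⟨ lsum-partitions-by-length gb k R (total i k (length γ)) (ℕ.<-≤-trans k≤n n<R) ⟩
      byLength (length γ) ∎

-- Partitions into parts congruent to a modulo m.

∧-true : ∀ x {y} → x ∧ y ≡ true → x ≡ true × y ≡ true
∧-true true eq = refl , eq

δ-true : ∀ x → δ x ≡ true → x ≡ + 0
δ-true (+ zero) _ = refl

goodPart-intro : ∀ a m M → goodPart a m (a ℕ.+ m ℕ.* M) ≡ true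
goodPart-intro a m M with a ℕ.≤? (a ℕ.+ m ℕ.* M) | m ∣? (a ℕ.+ m ℕ.* M ∸ a)
... | yes _ | yes _ = refl
... | yes _ | no ¬p = contradiction (divides M (trans (ℕ.m+n∸m≡n a (m ℕ.* M)) (ℕ.*-comm m M))) ¬p
... | no ¬p | _     = contradiction (ℕ.m≤m+n a (m ℕ.* M)) ¬p

goodPart-elim : ∀ a m x → goodPart a m x ≡ true → ∃[ M ] x ≡ a ℕ.+ m ℕ.* M
goodPart-elim a m x eq with a ℕ.≤? x | m ∣? (x ∸ a)
... | yes a≤x | yes (divides M x∸a≡M*m) =
  M , trans (sym (ℕ.m+[n∸m]≡n a≤x)) (cong (a ℕ.+_) (trans x∸a≡M*m (ℕ.*-comm M m)))
goodPart-elim a m x () | yes _ | no _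
goodPart-elim a m x () | no _  | _

-- Parts larger than n cannot occur in a partition of n, so all bounds from n on agree.
K-stable : ∀ g r n d → K g (n ℕ.+ d) r (+ n) ≡ K g n r (+ n)
K-stable g r       n zero    = cong (λ b → K g b r (+ n)) (ℕ.+-identityʳ n)
K-stable g zero    n (suc d) = refl
K-stable g (suc r) n (suc d) rewrite ℕ.+-suc n d = begin
  K g (n ℕ.+ d) (suc r) (+ n) xor (g (suc (n ℕ.+ d)) ∧ K g (suc (n ℕ.+ d)) r (+ n - + suc (n ℕ.+ d)))
    ≡⟨ cong (λ z → K g (n ℕ.+ d) (suc r) (+ n) xor (g (suc (n ℕ.+ d)) ∧ z))
         (trans (cong (K g (suc (n ℕ.+ d)) r) (ℤ.m-n≡m⊖n n (suc (n ℕ.+ d))))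
                (K-⊖ g (suc (n ℕ.+ d)) r (s≤s (ℕ.m≤m+n n d)))) ⟩
  K g (n ℕ.+ d) (suc r) (+ n) xor (g (suc (n ℕ.+ d)) ∧ false)
    ≡⟨ trans (cong (K g (n ℕ.+ d) (suc r) (+ n) xor_) (∧-zeroʳ _)) (xor-identityʳ _) ⟩
  K g (n ℕ.+ d) (suc r) (+ n)
    ≡⟨ K-stable g (suc r) n d ⟩
  K g n (suc r) (+ n) ∎
  where open ≡-Reasoning

module Parts (a m : ℕ) (1≤a : 1 ≤ a) (a≤m : a ≤ m) where

  g : ℕ → Bool
  g = goodPart a m

  g-self : g a ≡ true
  g-self = subst (λ x → g x ≡ true) (trans (cong (a ℕ.+_) (ℕ.*-zeroʳ m)) (ℕ.+-identityʳ a)) (goodPart-intro a m 0)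

  -- The argument is `suc x` because periodicity fails at 0 when a = m: then m is a good part and 0
  -- is not.
  g-periodic : ∀ x → g (suc x ℕ.+ m) ≡ g (suc x)
  g-periodic x = ⇔→≡ (mk⇔ down up)
    where
    down : g (suc x ℕ.+ m) ≡ true → g (suc x) ≡ true
    down eq with goodPart-elim a m _ eq
    ... | zero , p = contradiction
          (ℕ.≤-trans (ℕ.≤-reflexive (trans p (trans (cong (a ℕ.+_) (ℕ.*-zeroʳ m)) (ℕ.+-identityʳ a)))) a≤m)
          (ℕ.<⇒≱ (s≤s (ℕ.m≤n+m m x)))
    ... | suc M , p = subst (λ y → g y ≡ true)
          (sym (ℕ.+-cancelʳ-≡ m (suc x) (a ℕ.+ m ℕ.* M)
            (trans p (trans (cong (a ℕ.+_) (trans (ℕ.*-suc m M) (ℕ.+-comm m _))) (sym (ℕ.+-assoc a _ m))))))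
          (goodPart-intro a m M)
    up : g (suc x) ≡ true → g (suc x ℕ.+ m) ≡ true
    up eq with goodPart-elim a m _ eq
    ... | M , p = subst (λ y → g y ≡ true)
          (sym (trans (cong (ℕ._+ m) p) (trans (ℕ.+-assoc a _ m) (cong (a ℕ.+_) (trans (ℕ.+-comm _ m) (sym (ℕ.*-suc m M)))))))
          (goodPart-intro a m (suc M))

  g-below : ∀ x → x < a → g x ≡ false
  g-below x x<a = ¬-not λ eq → let (M , p) = goodPart-elim a m x eq in
    contradiction (ℕ.≤-trans (ℕ.m≤m+n a (m ℕ.* M)) (ℕ.≤-reflexive (sym p))) (ℕ.<⇒≱ x<a)

  g-gap : ∀ x → a < x → x ≤ m → g x ≡ false
  g-gap x a<x x≤m = ¬-not λ eq → impossible (goodPart-elim a m x eq)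
    where
    impossible : ¬ (∃[ M ] x ≡ a ℕ.+ m ℕ.* M)
    impossible (zero , p)  = ℕ.<⇒≢ a<x (sym (trans p (trans (cong (a ℕ.+_) (ℕ.*-zeroʳ m)) (ℕ.+-identityʳ a))))
    impossible (suc M , p) = ℕ.<⇒≱ (ℕ.<-≤-trans (ℕ.m<n+m m 1≤a) (ℕ.+-monoʳ-≤ a (ℕ.m≤m*n m (suc M))))
                               (ℕ.≤-trans (ℕ.≤-reflexive (sym p)) x≤m)

  K-skip : ∀ b r x → g (suc b) ≡ false → K g (suc b) r x ≡ K g b r x
  K-skip b zero    x eq = refl
  K-skip b (suc r) x eq rewrite eq = xor-identityʳ _

  K-below : ∀ b r x → b < a → K g b (suc r) x ≡ false
  K-below zero    r x b<a = refl
  K-below (suc b) r x b<a = trans (K-skip b (suc r) x (g-below (suc b) b<a)) (K-below b r x (ℕ.<⇒≤ b<a))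

  -- Up to m the only good part is a, so every part equals a and one of them can be removed.
  K-first : ∀ b r x → a ≤ b → b ≤ m → K g b (suc r) x ≡ K g b r (x - + a)
  K-first zero    r x a≤b b≤m = contradiction (ℕ.≤-trans 1≤a a≤b) (λ ())
  K-first (suc b) r x a≤b b≤m with ℕ.m≤n⇒m<n∨m≡n a≤b
  ... | inj₁ (s≤s a≤b′) = trans (K-skip b (suc r) x gap) (trans (K-first b r x a≤b′ (ℕ.<⇒≤ b≤m)) (sym (K-skip b r _ gap)))
    where gap = g-gap (suc b) (s≤s a≤b′) b≤m
  ... | inj₂ refl rewrite K-below b r x ℕ.≤-refl | g-self = refl

  -- Either a itself is a part and is removed, or all r + 1 parts are at least a + m and each is
  -- lowered by m. The proof is by induction on b, unfolding the largest part on both sides;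
  -- periodicity of `g` makes the two unfoldings match.
  K-pascal : ∀ b r x → K g (b ℕ.+ m) (suc r) x ≡ K g (b ℕ.+ m) r (x - + a) xor K g b (suc r) (x - + m * + suc r)
  K-pascal zero    r       x = trans (K-first m r x a≤m ℕ.≤-refl) (sym (xor-identityʳ _))
  K-pascal (suc b) zero    x rewrite K-pascal b zero x | g-periodic b = trans
    (xor-assoc (δ (x - + a)) _ _)
    (cong (λ z → δ (x - + a) xor (K g b 1 (x - + m * + 1) xor (g (suc b) ∧ δ z))) (arith x (+ suc b) (+ m)))
    where
    arith : ∀ x b m → x - (b + m) ≡ x - m * + 1 - b
    arith = solve-∀
  K-pascal (suc b) (suc r) x rewrite K-pascal b (suc r) x | K-pascal (suc b) r (x - + suc (b ℕ.+ m)) | g-periodic b = begin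
    (K g (b ℕ.+ m) (suc r) (x - + a) xor K g b (suc (suc r)) X) xor
      (G ∧ (K g B r (x - + B - + a) xor K g (suc b) (suc r) (x - + B - + m * + suc r)))
      ≡⟨ cong₂ (λ y z → (K g (b ℕ.+ m) (suc r) (x - + a) xor K g b (suc (suc r)) X) xor
           (G ∧ (K g B r y xor K g (suc b) (suc r) z))) (arith₁ x (+ B) (+ a)) (arith₂ x (+ suc b) (+ m) (+ suc r)) ⟩
    (K g (b ℕ.+ m) (suc r) (x - + a) xor K g b (suc (suc r)) X) xor
      (G ∧ (K g B r (x - + a - + B) xor K g (suc b) (suc r) (X - + suc b)))
      ≡⟨ cong ((K g (b ℕ.+ m) (suc r) (x - + a) xor K g b (suc (suc r)) X) xor_) (∧-distribˡ-xor G _ _) ⟩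
    (K g (b ℕ.+ m) (suc r) (x - + a) xor K g b (suc (suc r)) X) xor
      ((G ∧ K g B r (x - + a - + B)) xor (G ∧ K g (suc b) (suc r) (X - + suc b)))
      ≡⟨ xor-interchange (K g (b ℕ.+ m) (suc r) (x - + a)) _ _ _ ⟩
    (K g (b ℕ.+ m) (suc r) (x - + a) xor (G ∧ K g B r (x - + a - + B))) xor
      (K g b (suc (suc r)) X xor (G ∧ K g (suc b) (suc r) (X - + suc b))) ∎
    where
    open ≡-Reasoning
    B = suc (b ℕ.+ m)
    G = g (suc b)
    X = x - + m * + suc (suc r)
    arith₁ : ∀ x b a → x - b - a ≡ x - a - b
    arith₁ = solve-∀
    arith₂ : ∀ x b m r → x - (b + m) - m * r ≡ x - m * (+ 1 + r) - b
    arith₂ = solve-∀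

  K-support : ∀ b r x → K g b r x ≡ true → ∃[ N ] x ≡ + a * + r + + m * + N
  K-support b       zero    x eq = 0 , trans (δ-true x eq) (sym (cong₂ _+_ (ℤ.*-zeroʳ (+ a)) (ℤ.*-zeroʳ (+ m))))
  K-support (suc b) (suc r) x eq with K g b (suc r) x in eq′
  ... | true  = K-support b (suc r) x eq′
  ... | false with ∧-true (g (suc b)) eq
  ...   | gb , eq″ with goodPart-elim a m (suc b) gb | K-support (suc b) r _ eq″
  ...     | M , p | N , q = M ℕ.+ N , (begin
    x                                                   ≡⟨ arith₁ x (+ suc b) ⟩
    (x - + suc b) + + suc b                             ≡⟨ cong₂ _+_ q (trans (cong +_ p) (cong (λ z → + a + z) (ℤ.pos-* m M))) ⟩
    (+ a * + r + + m * + N) + (+ a + + m * + M)         ≡⟨ arith₂ (+ a) (+ r) (+ m) (+ N) (+ M) ⟩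
    + a * + suc r + + m * + (M ℕ.+ N)                   ∎)
    where
    open ≡-Reasoning
    arith₁ : ∀ x b → x ≡ (x - b) + b
    arith₁ = solve-∀
    arith₂ : ∀ a r m N M → (a * r + m * N) + (a + m * M) ≡ a * (+ 1 + r) + m * (M + N)
    arith₂ = solve-∀

  -- The coefficients of q^{ar} / (q^m; q^m)_r modulo 2.
  α : ℕ → ℤ → Bool
  α r (+ n)    = K g n r (+ n)
  α r -[1+ n ] = false

  α-K : ∀ b r x → x ℤ.≤ + b → K g b r x ≡ α r x
  α-K b r (+ n)    (ℤ.+≤+ n≤b) = trans (cong (λ c → K g c r (+ n)) (sym (ℕ.m+[n∸m]≡n n≤b))) (K-stable g r n (b ∸ n))
  α-K b r -[1+ n ] _           = K-neg g b r n

  α-zero : ∀ x → α 0 x ≡ δ x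
  α-zero (+ n)    = refl
  α-zero -[1+ n ] = refl

  α-suc : ∀ r x → α (suc r) x ≡ α r (x - + a) xor α (suc r) (x - + m * + suc r)
  α-suc r x = begin
    α (suc r) x
      ≡⟨ sym (α-K (b ℕ.+ m) (suc r) x (ℤ.≤-trans x≤b b≤b+m)) ⟩
    K g (b ℕ.+ m) (suc r) x
      ≡⟨ K-pascal b r x ⟩
    K g (b ℕ.+ m) r (x - + a) xor K g b (suc r) (x - + m * + suc r)
      ≡⟨ cong₂ _xor_ (α-K (b ℕ.+ m) r _ (ℤ.≤-trans (ℤ.i≤j⇒i-k≤j (+ a) x≤b) b≤b+m))
           (α-K b (suc r) _ (subst (λ z → x - z ℤ.≤ + b) (ℤ.pos-* m (suc r)) (ℤ.i≤j⇒i-k≤j (+ (m ℕ.* suc r)) x≤b))) ⟩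
    α r (x - + a) xor α (suc r) (x - + m * + suc r) ∎
    where
    open ≡-Reasoning
    -- This bound is at least each of the three arguments, so every `K` in `K-pascal` can be
    -- replaced by its bound-free version `α`.
    b = ∣ x ∣
    i≤∣i∣ : ∀ i → i ℤ.≤ + ∣ i ∣
    i≤∣i∣ (+ n)    = ℤ.≤-refl
    i≤∣i∣ -[1+ n ] = ℤ.-≤+
    x≤b = i≤∣i∣ x
    b≤b+m : + b ℤ.≤ + (b ℕ.+ m)
    b≤b+m = ℤ.+≤+ (ℕ.m≤m+n b m)

  α-support : ∀ r x → α r x ≡ true → ∃[ N ] x ≡ + a * + r + + m * + N
  α-support r (+ n) eq = K-support n r (+ n) eq


-- Triangular numbers and the exponents of the theta series.

choose2 : ℕ → ℕ
choose2 zero    = 0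
choose2 (suc n) = n ℕ.+ choose2 n

-- The binomial coefficient (j choose 2) = j (j - 1) / 2.
tri : ℤ → ℤ
tri (+ n)    = + choose2 n
tri -[1+ n ] = + choose2 (2 ℕ.+ n)

tri-suc : ∀ j → tri (j + + 1) ≡ tri j + j
tri-suc (+ n)        rewrite ℕ.+-comm n 1 = cong +_ (ℕ.+-comm n (choose2 n))
tri-suc -[1+ zero ]  = refl
tri-suc -[1+ suc n ] = arith (+ n) (+ choose2 n)
  where
  arith : ∀ n t → + 1 + n + (n + t) ≡ (+ 1 + (+ 1 + n) + (+ 1 + n + (n + t))) - (+ 1 + (+ 1 + n))
  arith = solve-∀

tri-double : ∀ j → + 2 * tri j ≡ j * (j - + 1)
tri-double (+ n)    = double n
  where
  arith : ∀ n t → + 2 * (n + t) ≡ + 2 * n + + 2 * t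
  arith = solve-∀
  arith′ : ∀ n → + 2 * n + n * (n - + 1) ≡ (+ 1 + n) * (+ 1 + n - + 1)
  arith′ = solve-∀
  double : ∀ n → + 2 * + choose2 n ≡ + n * (+ n - + 1)
  double zero    = refl
  double (suc n) = trans (arith (+ n) (+ choose2 n)) (trans (cong (λ z → + 2 * + n + z) (double n)) (arith′ (+ n)))
tri-double -[1+ n ] = trans (tri-double (+ (2 ℕ.+ n))) (arith (+ n))
  where
  arith : ∀ n → (+ 2 + n) * (+ 2 + n - + 1) ≡ (- (+ 1 + n)) * (- (+ 1 + n) - + 1)
  arith = solve-∀

-- With i = k - r and j = s, the cross term (k - r) s and the contribution r s of ρ add up to k s,
-- which separates r from s. The proof doubles both sides to avoid division.
tri-+ : ∀ i j → tri (i + j) ≡ tri i + tri j + i * j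
tri-+ i j = ℤ.*-cancelˡ-≡ (+ 2) _ _ (begin
  + 2 * tri (i + j)                                   ≡⟨ tri-double (i + j) ⟩
  (i + j) * (i + j - + 1)                             ≡⟨ arith₁ i j ⟩
  i * (i - + 1) + j * (j - + 1) + + 2 * (i * j)       ≡⟨ cong₂ (λ x y → x + y + + 2 * (i * j)) (sym (tri-double i)) (sym (tri-double j)) ⟩
  + 2 * tri i + + 2 * tri j + + 2 * (i * j)           ≡⟨ arith₂ (tri i) (tri j) (i * j) ⟩
  + 2 * (tri i + tri j + i * j) ∎)
  where
  open ≡-Reasoning
  arith₁ : ∀ i j → (i + j) * (i + j - + 1) ≡ i * (i - + 1) + j * (j - + 1) + + 2 * (i * j)
  arith₁ = solve-∀
  arith₂ : ∀ x y z → + 2 * x + + 2 * y + + 2 * z ≡ + 2 * (x + y + z)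
  arith₂ = solve-∀

tri-neg : ∀ j → tri (- j) ≡ tri j + j
tri-neg j = ℤ.*-cancelˡ-≡ (+ 2) _ _ (trans (tri-double (- j))
  (trans (arith j) (trans (cong (_+ + 2 * j) (sym (tri-double j))) (sym (ℤ.*-distribˡ-+ (+ 2) (tri j) j)))))
  where
  arith : ∀ j → (- j) * (- j - + 1) ≡ j * (j - + 1) + + 2 * j
  arith = solve-∀

-- Theta a m j is the exponent in the theta series ∑ q^(m j (j - 1) / 2 + a j), the sum running over all integers j.
Theta : ℕ → ℕ → ℤ → ℤ
Theta a m j = + a * j + + m * tri j

-- Since `tri (- j)` is `tri j + j`, negating the index turns a into m - a = b. Negative indices
-- thus reduce to positive ones with γ and σ exchanged.
Theta-neg : ∀ a b {m} → m ≡ a ℕ.+ b → ∀ j → Theta a m (- j) ≡ Theta b m j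
Theta-neg a b refl j = trans (cong (λ z → + a * (- j) + + (a ℕ.+ b) * z) (tri-neg j)) (arith (+ a) (+ b) j (tri j))
  where
  arith : ∀ a b j t → a * (- j) + (a + b) * (t + j) ≡ b * j + (a + b) * t
  arith = solve-∀

Theta-pos : ∀ a m n → Theta a m (+ n) ≡ + (a ℕ.* n ℕ.+ m ℕ.* choose2 n)
Theta-pos a m n = cong₂ _+_ (sym (ℤ.pos-* a n)) (sym (ℤ.pos-* m (choose2 n)))

-- This makes the theta sum finite at each n: an index j with absolute value above n leaves a
-- negative exponent.
∣j∣≤Theta : ∀ {a b m} → m ≡ a ℕ.+ b → 1 ≤ a → 1 ≤ b → ∀ j → + ∣ j ∣ ℤ.≤ Theta a m j
∣j∣≤Theta {a} {b} {m} m≡a+b 1≤a 1≤b = go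
  where
  bound : ∀ a n → 1 ≤ a → + n ℤ.≤ Theta a m (+ n)
  bound (suc a) n 1≤a rewrite Theta-pos (suc a) m n = ℤ.+≤+ (ℕ.≤-trans (ℕ.m≤m+n n (a ℕ.* n)) (ℕ.m≤m+n _ (m ℕ.* choose2 n)))
  go : ∀ j → + ∣ j ∣ ℤ.≤ Theta a m j
  go (+ n)    = bound a n 1≤a
  go -[1+ n ] = subst (+ suc n ℤ.≤_) (sym (Theta-neg a b m≡a+b (+ suc n))) (bound b (suc n) 1≤b)

-- Sums over -B ≤ j ≤ B and their invariance under translation.

bisum : ℕ → (ℤ → Bool) → Bool
bisum B f = f (+ 0) xor xsum B (λ i → f (+ suc i) xor f -[1+ i ])

bisum-cong : ∀ B {f g : ℤ → Bool} → (∀ j → f j ≡ g j) → bisum B f ≡ bisum B g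
bisum-cong B f≗g = cong₂ _xor_ (f≗g (+ 0)) (xsum-cong B (λ i _ → cong₂ _xor_ (f≗g (+ suc i)) (f≗g -[1+ i ])))

bisum-xsum : ∀ B n (f : ℤ → ℕ → Bool) → bisum B (λ j → xsum n (f j)) ≡ xsum n (λ i → bisum B (λ j → f j i))
bisum-xsum B n f = sym (trans
  (xsum-xor n (f (+ 0)) _)
  (cong (xsum n (f (+ 0)) xor_) (trans
    (xsum-swap n B (λ i j → f (+ suc j) i xor f -[1+ j ] i))
    (xsum-cong B (λ j _ → xsum-xor n (f (+ suc j)) (f -[1+ j ]))))))

bisum-xsum-xsum : ∀ B n (f : ℤ → ℕ → ℕ → Bool) →
  bisum B (λ j → xsum n (λ r → xsum n (f j r))) ≡ xsum n (λ r → xsum n (λ s → bisum B (λ j → f j r s)))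
bisum-xsum-xsum B n f = trans (bisum-xsum B n (λ j r → xsum n (f j r)))
                              (xsum-cong n (λ r _ → bisum-xsum B n (λ j → f j r)))

bisum-suc : ∀ B f → bisum (suc B) f ≡ bisum B f xor (f (+ suc B) xor f -[1+ B ])
bisum-suc B f = trans (cong (f (+ 0) xor_) (xsum-last B _)) (sym (xor-assoc (f (+ 0)) _ _))

-- Moving the window by one loses the term at -B and gains the one at B + 1.
bisum-translate : ∀ B f → bisum B (λ j → f (j + + 1)) xor f (- + B) ≡ bisum B f xor f (+ suc B)
bisum-translate zero    f = trans (cong (_xor f (+ 0)) (xor-identityʳ (f (+ 1))))
  (trans (xor-comm (f (+ 1)) (f (+ 0))) (cong (_xor f (+ 1)) (sym (xor-identityʳ (f (+ 0))))))
bisum-translate (suc B) f = begin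
  bisum (suc B) f′ xor f -[1+ B ]
    ≡⟨ cong (_xor f -[1+ B ]) (bisum-suc B f′) ⟩
  (bisum B f′ xor (f (+ suc B + + 1) xor f (-[1+ B ] + + 1))) xor f -[1+ B ]
    ≡⟨ cong₂ (λ x y → (bisum B f′ xor (f x xor f y)) xor f -[1+ B ]) (cong +_ (ℕ.+-comm (suc B) 1)) (arith (+ B)) ⟩
  (bisum B f′ xor (f (+ suc (suc B)) xor f (- + B))) xor f -[1+ B ]
    ≡⟨ rearrange₁ (bisum B f′) (f (+ suc (suc B))) (f (- + B)) (f -[1+ B ]) ⟩
  (bisum B f′ xor f (- + B)) xor (f -[1+ B ] xor f (+ suc (suc B)))
    ≡⟨ cong (_xor (f -[1+ B ] xor f (+ suc (suc B)))) (bisum-translate B f) ⟩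
  (bisum B f xor f (+ suc B)) xor (f -[1+ B ] xor f (+ suc (suc B)))
    ≡⟨ trans (sym (xor-assoc (bisum B f xor f (+ suc B)) _ _))
         (cong (_xor f (+ suc (suc B))) (trans (xor-assoc (bisum B f) _ _) (sym (bisum-suc B f)))) ⟩
  bisum (suc B) f xor f (+ suc (suc B)) ∎
  where
  open ≡-Reasoning
  f′ = λ j → f (j + + 1)
  arith : ∀ B → - (+ 1 + B) + + 1 ≡ - B
  arith = solve-∀
  rearrange₁ : ∀ x y z w → (x xor (y xor z)) xor w ≡ (x xor z) xor (w xor y)
  rearrange₁ x y z w = trans (cong (λ t → (x xor t) xor w) (xor-comm y z))
    (trans (cong (_xor w) (sym (xor-assoc x z y))) (trans (xor-assoc (x xor z) y w) (cong ((x xor z) xor_) (xor-comm y w))))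

VanishesFrom : ℕ → (ℤ → Bool) → Set
VanishesFrom B f = ∀ j → B ≤ ∣ j ∣ → f j ≡ false

VanishesFrom-translate : ∀ {B f} k → VanishesFrom B f → VanishesFrom (B ℕ.+ ∣ k ∣) (λ j → f (j + k))
VanishesFrom-translate {B} {f} k v j B+k≤j = v (j + k) (ℕ.+-cancelʳ-≤ (∣ k ∣) B (∣ j + k ∣) (ℕ.≤-trans B+k≤j
  (subst (λ i → ∣ i ∣ ≤ ∣ j + k ∣ ℕ.+ ∣ k ∣) (arith j k) (ℤ.∣i-j∣≤∣i∣+∣j∣ (j + k) k))))
  where
  arith : ∀ j k → j + k - k ≡ j
  arith = solve-∀

bisum-+ : ∀ B₀ s B f → VanishesFrom B₀ f → B₀ ℕ.+ s ≤ B → bisum B (λ j → f (j + + s)) ≡ bisum B f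
bisum-+ B₀ zero    B f v _ = bisum-cong B (λ j → cong f (ℤ.+-identityʳ j))
bisum-+ B₀ (suc s) B f v B₀+1+s≤B = begin
  bisum B (λ j → f (j + + suc s))
    ≡⟨ bisum-cong B (λ j → cong f (arith j (+ s))) ⟩
  bisum B (λ j → f (j + + 1 + + s))
    ≡⟨ sym (trans (cong (bisum B (λ j → f (j + + 1 + + s)) xor_) (v′ (- + B) (subst (B₀ ℕ.+ s ≤_) (sym (ℤ.∣-i∣≡∣i∣ (+ B))) B₀+s≤B)))
              (xor-identityʳ _)) ⟩
  bisum B (λ j → f (j + + 1 + + s)) xor f (- + B + + s)
    ≡⟨ bisum-translate B (λ j → f (j + + s)) ⟩
  bisum B (λ j → f (j + + s)) xor f (+ suc B + + s)
    ≡⟨ trans (cong (bisum B (λ j → f (j + + s)) xor_) (v′ (+ suc B) (ℕ.m≤n⇒m≤1+n B₀+s≤B))) (xor-identityʳ _) ⟩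
  bisum B (λ j → f (j + + s))
    ≡⟨ bisum-+ B₀ s B f v B₀+s≤B ⟩
  bisum B f ∎
  where
  open ≡-Reasoning
  v′ = VanishesFrom-translate {f = f} (+ s) v
  B₀+s≤B = ℕ.≤-trans (ℕ.+-monoʳ-≤ B₀ (ℕ.n≤1+n s)) B₀+1+s≤B
  arith : ∀ j s → j + (+ 1 + s) ≡ j + + 1 + s
  arith = solve-∀

-- Since `bisum-+` only shifts upwards, the shift by -r is undone by a shift by r. So r enters the
-- bound twice: once because the shifted function vanishes later, once for the shift itself.
bisum-shift : ∀ B₀ r s B f → VanishesFrom B₀ f → B₀ ℕ.+ s ℕ.+ r ℕ.+ r ≤ B →
  bisum B (λ k → f (k - + r + + s)) ≡ bisum B f
bisum-shift B₀ r s B f v le = begin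
  bisum B h
    ≡⟨ sym (bisum-+ (B₀ ℕ.+ s ℕ.+ r) r B h hv le) ⟩
  bisum B (λ k → f (k + + r - + r + + s))
    ≡⟨ bisum-cong B (λ k → cong f (arith k (+ r) (+ s))) ⟩
  bisum B (λ k → f (k + + s))
    ≡⟨ bisum-+ B₀ s B f v (ℕ.≤-trans (ℕ.≤-trans (ℕ.m≤m+n _ r) (ℕ.m≤m+n _ r)) le) ⟩
  bisum B f ∎
  where
  open ≡-Reasoning
  h : ℤ → Bool
  h k = f (k - + r + + s)
  hv : VanishesFrom (B₀ ℕ.+ s ℕ.+ r) h
  hv = subst (λ t → VanishesFrom (B₀ ℕ.+ s ℕ.+ t) h) (ℤ.∣-i∣≡∣i∣ (+ r))
         (VanishesFrom-translate {f = λ k → f (k + + s)} (- + r) (VanishesFrom-translate {f = f} (+ s) v))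
  arith : ∀ k r s → k + r - r + s ≡ k + s
  arith = solve-∀

-- The properties of the part series, stated abstractly so that a and b can be exchanged, and the
-- vanishing sum over r.

record PartSeries (a m : ℕ) : Set where
  field
    coeff   : ℕ → ℤ → Bool
    zeroth  : ∀ x → coeff 0 x ≡ δ x
    next    : ∀ r x → coeff (suc r) x ≡ coeff r (x - + a) xor coeff (suc r) (x - + m * + suc r)
    support : ∀ r x → coeff r x ≡ true → ∃[ N ] x ≡ + a * + r + + m * + N

partSeries : ∀ a m → 1 ≤ a → a ≤ m → PartSeries a m
partSeries a m 1≤a a≤m = record
  { coeff = α ; zeroth = α-zero ; next = α-suc ; support = α-support }
  where open Parts a m 1≤a a≤m

module _ {a m : ℕ} (P : PartSeries a m) where
  open PartSeries P

  support-≥ : ∀ r x → coeff r x ≡ true → + (a ℕ.* r) ℤ.≤ x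
  support-≥ r x eq with support r x eq
  ... | N , refl rewrite sym (ℤ.pos-* a r) | sym (ℤ.pos-* m N) = ℤ.+≤+ (ℕ.m≤m+n (a ℕ.* r) (m ℕ.* N))

  coeff-neg : ∀ r x → x ℤ.< + 0 → coeff r x ≡ false
  coeff-neg r x x<0 = ¬-not λ eq → ℤ.<⇒≱ x<0 (ℤ.≤-trans (ℤ.+≤+ z≤n) (support-≥ r x eq))

  -- The coefficients of 1 / (q^m; q^m)_r modulo 2.
  u : ℕ → ℤ → Bool
  u r x = coeff r (x + + a * + r)

  u-zero : ∀ x → u 0 x ≡ δ x
  u-zero x = trans (zeroth _) (cong δ (trans (cong (λ z → x + z) (ℤ.*-zeroʳ (+ a))) (ℤ.+-identityʳ x)))

  u-suc : ∀ r x → u (suc r) x ≡ u r x xor u (suc r) (x - + m * + suc r)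
  u-suc r x = trans (next r (x + + a * + suc r))
    (cong₂ (λ y z → coeff r y xor coeff (suc r) z) (arith₁ x (+ a) (+ r)) (arith₂ x (+ a * + suc r) (+ m * + suc r)))
    where
    arith₁ : ∀ x a r → x + a * (+ 1 + r) - a ≡ x + a * r
    arith₁ = solve-∀
    arith₂ : ∀ x y z → x + y - z ≡ x - z + y
    arith₂ = solve-∀

  u-neg : ∀ r x → x ℤ.< + 0 → u r x ≡ false
  u-neg r x x<0 = ¬-not λ eq → ℤ.<⇒≱ (ℤ.+-monoˡ-< (+ a * + r) x<0)
    (subst (ℤ._≤ x + + a * + r) (trans (ℤ.pos-* a r) (sym (ℤ.+-identityˡ _))) (support-≥ r _ eq))

  -- The coefficient of q^x in the sum of q^(m tri (k - r)) / (q^m; q^m)_r over r < R.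
  V : ℕ → ℤ → ℤ → Bool
  V R k x = xsum R (λ r → u r (x - + m * tri (k - + r)))

  -- Up to truncation, passing from k to k + 1 multiplies by 1 + q^(m k), which is 1 + 1 at k = 0.
  -- The terms match after `u-suc` is applied to each r + 1 and `tri-suc` to the index k - r.
  V-suc : ∀ R k x → V (suc R) (k + + 1) x ≡ V (suc R) k (x - + m * k) xor V R k x
  V-suc R k x = begin
    u 0 (x - + m * tri (k + + 1 - + 0)) xor xsum R (λ r → u (suc r) (x - + m * tri (k + + 1 - + suc r)))
      ≡⟨ cong₂ _xor_ (cong (u 0) first) (trans (xsum-cong R (λ r _ → split r)) (xsum-xor R _ _)) ⟩
    u 0 (x - + m * k - + m * tri (k - + 0)) xor
      (xsum R (λ r → u (suc r) (x - + m * k - + m * tri (k - + suc r))) xor V R k x)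
      ≡⟨ sym (xor-assoc (u 0 (x - + m * k - + m * tri (k - + 0))) _ _) ⟩
    V (suc R) k (x - + m * k) xor V R k x ∎
    where
    open ≡-Reasoning
    arith₁ : ∀ x m k t → x - m * (t + k) ≡ x - m * k - m * t
    arith₁ = solve-∀
    arith₂ : ∀ k r → k + + 1 - r ≡ k - r + + 1
    arith₂ = solve-∀
    first : x - + m * tri (k + + 1 - + 0) ≡ x - + m * k - + m * tri (k - + 0)
    first = trans (cong (λ i → x - + m * i) (trans (cong tri (arith₂ k (+ 0)))
                    (trans (tri-suc (k - + 0)) (cong (λ z → tri (k - + 0) + z) (ℤ.+-identityʳ k)))))
                  (arith₁ x (+ m) k (tri (k - + 0)))
    arith₃ : ∀ k r → k + + 1 - (+ 1 + r) ≡ k - r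
    arith₃ = solve-∀
    arith₄ : ∀ k r → k - r ≡ k - (+ 1 + r) + + 1
    arith₄ = solve-∀
    arith₅ : ∀ x m k t r → x - m * (t + (k - r)) - m * r ≡ x - m * k - m * t
    arith₅ = solve-∀
    split : ∀ r → u (suc r) (x - + m * tri (k + + 1 - + suc r)) ≡
      u (suc r) (x - + m * k - + m * tri (k - + suc r)) xor u r (x - + m * tri (k - + r))
    split r = begin
      u (suc r) (x - + m * tri (k + + 1 - + suc r))
        ≡⟨ cong (λ i → u (suc r) (x - + m * tri i)) (arith₃ k (+ r)) ⟩
      u (suc r) (x - + m * tri (k - + r))
        ≡⟨ u-suc r (x - + m * tri (k - + r)) ⟩
      u r (x - + m * tri (k - + r)) xor u (suc r) (x - + m * tri (k - + r) - + m * + suc r)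
        ≡⟨ xor-comm (u r (x - + m * tri (k - + r))) _ ⟩
      u (suc r) (x - + m * tri (k - + r) - + m * + suc r) xor u r (x - + m * tri (k - + r))
        ≡⟨ cong (λ y → u (suc r) y xor u r (x - + m * tri (k - + r))) (trans
             (cong (λ t → x - + m * t - + m * + suc r) (trans (cong tri (arith₄ k (+ r))) (tri-suc (k - + suc r))))
             (arith₅ x (+ m) k (tri (k - + suc r)) (+ suc r))) ⟩
      u (suc r) (x - + m * k - + m * tri (k - + suc r)) xor u r (x - + m * tri (k - + r)) ∎

  -- Up to a power of q, V R k is the truncated product ∏_{i ≥ 1} (1 + q^(m (i - k))), whose factor i = k vanishes modulo 2.
  V-vanishes : 1 ≤ m → ∀ k R x → x + + suc k ℤ.< + R → V R (+ suc k) x ≡ false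
  V-vanishes 1≤m k zero    x x+k<R = refl
  V-vanishes 1≤m zero (suc R) x x+1<1+R = begin
    V (suc R) (+ 1) x
      ≡⟨ V-suc R (+ 0) x ⟩
    V (suc R) (+ 0) (x - + m * + 0) xor V R (+ 0) x
      ≡⟨ cong (_xor V R (+ 0) x) (cong (V (suc R) (+ 0)) (trans (cong (λ z → x - z) (ℤ.*-zeroʳ (+ m))) (ℤ.+-identityʳ x))) ⟩
    V (suc R) (+ 0) x xor V R (+ 0) x
      -- The two truncations differ only in the term r = R, which vanishes because m tri (-R) is at
      -- least R and hence exceeds x.
      ≡⟨ cong (_xor V R (+ 0) x) (trans (xsum-last R _) (trans (cong (V R (+ 0) x xor_) top) (xor-identityʳ (V R (+ 0) x)))) ⟩
    V R (+ 0) x xor V R (+ 0) x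
      ≡⟨ xor-same (V R (+ 0) x) ⟩
    false ∎
    where
    open ≡-Reasoning
    x<R : x ℤ.< + R
    x<R = subst₂ ℤ._<_ (arith x) (arith (+ R)) (ℤ.+-monoˡ-< (- + 1) (subst (λ n → x + + 1 ℤ.< + n) (ℕ.+-comm 1 R) x+1<1+R))
      where
      arith : ∀ x → x + + 1 + - + 1 ≡ x
      arith = solve-∀
    R≤mtri : ∀ R m → 1 ≤ m → + R ℤ.≤ + m * tri (+ 0 - + R)
    R≤mtri zero    m       _ = subst (+ 0 ℤ.≤_) (sym (ℤ.*-zeroʳ (+ m))) ℤ.≤-refl
    R≤mtri (suc R) (suc m) _ = ℤ.+≤+ (ℕ.≤-trans (ℕ.m≤m+n (suc R) (choose2 (suc R))) (ℕ.m≤m+n (choose2 (2 ℕ.+ R)) (m ℕ.* choose2 (2 ℕ.+ R))))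
    top : u R (x - + m * tri (+ 0 - + R)) ≡ false
    top = u-neg R _ (subst (x - + m * tri (+ 0 - + R) ℤ.<_) (ℤ.+-inverseʳ (+ R))
            (ℤ.+-mono-<-≤ x<R (ℤ.neg-mono-≤ (R≤mtri R m 1≤m))))
  V-vanishes 1≤m (suc k) (suc R) x x+2+k<1+R = trans
    (trans (cong (λ j → V (suc R) j x) (cong +_ (ℕ.+-comm 1 (suc k)))) (V-suc R (+ suc k) x))
    (cong₂ _xor_
      (V-vanishes 1≤m k (suc R) (x - + m * + suc k) (ℤ.≤-<-trans (ℤ.+-mono-≤ le (ℤ.+≤+ (ℕ.n≤1+n (suc k)))) x+2+k<1+R))
      (V-vanishes 1≤m k R x (subst₂ ℤ._<_ (arith₁ x (+ suc k)) (arith₂ (+ R)) (ℤ.+-monoˡ-< (- + 1) x+2+k<1+R))))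
    where
    le : x - + m * + suc k ℤ.≤ x
    le = subst (λ z → x - z ℤ.≤ x) (ℤ.pos-* m (suc k)) (ℤ.i≤j⇒i-k≤j (+ (m ℕ.* suc k)) ℤ.≤-refl)
    arith₁ : ∀ x k → x + (+ 1 + k) + - + 1 ≡ x + k
    arith₁ = solve-∀
    arith₂ : ∀ R → + 1 + R + - + 1 ≡ R
    arith₂ = solve-∀

-- Convolution and the double series over the numbers of parts.

collapse : ∀ R (f : ℤ → Bool) x → (∀ y → y ℤ.< + 0 → f y ≡ false) → x ℤ.< + R →
  xsum R (λ k → f (+ k) ∧ δ (x - + k)) ≡ f x
collapse R f (+ n) f-neg (ℤ.+<+ n<R) = trans
  (xsum-single R n n<R (λ k _ k≢n → trans
    (cong (f (+ k) ∧_) (δ-≢ _ (λ eq → k≢n (sym (ℤ.+-injective (ℤ.i-j≡0⇒i≡j (+ n) (+ k) eq))))))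
    (∧-zeroʳ _)))
  (trans (cong (λ z → f (+ n) ∧ δ z) (ℤ.+-inverseʳ (+ n))) (∧-identityʳ _))
collapse R f -[1+ n ] f-neg _ = trans
  (xsum-false R (λ k _ → trans (cong (λ z → f (+ k) ∧ δ z) (ℤ.neg-minus-pos n k)) (∧-zeroʳ _)))
  (sym (f-neg _ ℤ.-<+))

conv : ℕ → (ℤ → Bool) → (ℤ → Bool) → ℤ → Bool
conv R f h x = xsum R (λ i → f (+ i) ∧ h (x - + i))

-- Expanding h against `δ` by `collapse` gives a double sum whose two indices can be interchanged.
conv-comm : ∀ R f h x → (∀ y → y ℤ.< + 0 → f y ≡ false) → (∀ y → y ℤ.< + 0 → h y ≡ false) → x ℤ.< + R →
  conv R f h x ≡ conv R h f x
conv-comm R f h x f-neg h-neg x<R = begin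
  xsum R (λ i → f (+ i) ∧ h (x - + i))
    ≡⟨ xsum-cong R (λ i _ → cong (f (+ i) ∧_) (sym (collapse R h (x - + i) h-neg (below i)))) ⟩
  xsum R (λ i → f (+ i) ∧ xsum R (λ k → h (+ k) ∧ δ (x - + i - + k)))
    ≡⟨ xsum-cong R (λ i _ → ∧-xsum (f (+ i)) R _) ⟩
  xsum R (λ i → xsum R (λ k → f (+ i) ∧ (h (+ k) ∧ δ (x - + i - + k))))
    ≡⟨ xsum-swap R R _ ⟩
  xsum R (λ k → xsum R (λ i → f (+ i) ∧ (h (+ k) ∧ δ (x - + i - + k))))
    ≡⟨ xsum-cong R (λ k _ → xsum-cong R (λ i _ → trans (∧-left-comm (f (+ i)) (h (+ k)) _)
         (cong (λ z → h (+ k) ∧ (f (+ i) ∧ δ z)) (arith x (+ i) (+ k))))) ⟩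
  xsum R (λ k → xsum R (λ i → h (+ k) ∧ (f (+ i) ∧ δ (x - + k - + i))))
    ≡⟨ xsum-cong R (λ k _ → sym (∧-xsum (h (+ k)) R _)) ⟩
  xsum R (λ k → h (+ k) ∧ xsum R (λ i → f (+ i) ∧ δ (x - + k - + i)))
    ≡⟨ xsum-cong R (λ k _ → cong (h (+ k) ∧_) (collapse R f (x - + k) f-neg (below k))) ⟩
  xsum R (λ k → h (+ k) ∧ f (x - + k)) ∎
  where
  open ≡-Reasoning
  below : ∀ i → x - + i ℤ.< + R
  below i = ℤ.≤-<-trans (ℤ.i≤j⇒i-k≤j (+ i) ℤ.≤-refl) x<R
  arith : ∀ x i k → x - i - k ≡ x - k - i
  arith = solve-∀

-- The coefficient of q^x in the generating function modulo 2, with γ having r parts, σ having s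
-- parts and ρ contributing m r s; `cpParity-series` identifies the two.
series : ∀ {a b m} → PartSeries a m → PartSeries b m → ℕ → ℤ → Bool
series {m = m} P Q R x = xsum R (λ r → xsum R (λ s →
  conv R (PartSeries.coeff P r) (PartSeries.coeff Q s) (x - + m * + r * + s)))

-- The product of the generating function with the theta series.

module Product {a b m : ℕ} (m≡a+b : m ≡ a ℕ.+ b) (1≤a : 1 ≤ a) (1≤b : 1 ≤ b) where

  exponent : ℕ → ℤ → ℕ → ℕ → ℤ
  exponent n j r s = + n - Theta a m j - + m * + r * + s

  exponent-≤ : ∀ n j r s → exponent n j r s ℤ.≤ + n - Theta a m j
  exponent-≤ n j r s = subst (λ z → exponent n j r s ℤ.≤ z) (ℤ.+-identityʳ (+ n - Theta a m j))
    (ℤ.+-monoʳ-≤ (+ n - Theta a m j) (ℤ.neg-mono-≤ 0≤mrs))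
    where
    0≤mrs : + 0 ℤ.≤ + m * + r * + s
    0≤mrs rewrite sym (ℤ.pos-* m r) | sym (ℤ.pos-* (m ℕ.* r) s) = ℤ.+≤+ z≤n

  exponent-≤-∣j∣ : ∀ n j r s → exponent n j r s ℤ.≤ + n - + ∣ j ∣
  exponent-≤-∣j∣ n j r s = ℤ.≤-trans (exponent-≤ n j r s)
    (ℤ.+-monoʳ-≤ (+ n) (ℤ.neg-mono-≤ (∣j∣≤Theta m≡a+b 1≤a 1≤b j)))

  exponent-< : ∀ n j r s {R} → n < R → exponent n j r s ℤ.< + R
  exponent-< n j r s n<R = ℤ.≤-<-trans (exponent-≤-∣j∣ n j r s) (ℤ.≤-<-trans (ℤ.i-j≤i (+ n) (+ ∣ j ∣)) (ℤ.+<+ n<R))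

  module _ (P : PartSeries a m) (Q : PartSeries b m) where

    open PartSeries P renaming (coeff to α)
    open PartSeries Q renaming (coeff to β)

    summand : ℕ → ℕ → ℤ → ℕ → ℕ → Bool
    summand R n j r s = conv R (α r) (β s) (exponent n j r s)

    -- For fixed s and i, the exponent depends on r only through m tri (k - r) - a r, so that the sum over r is a V.
    summand-positive : ∀ n R k → n < R →
      xsum R (λ r → xsum R (λ s → summand R n (+ suc k - + r + + s) r s)) ≡ false
    summand-positive n R k n<R = begin
      xsum R (λ r → xsum R (λ s → conv R (α r) (β s) (e r s)))
        ≡⟨ xsum-cong R (λ r _ → xsum-cong R (λ s _ →
             conv-comm R (α r) (β s) (e r s) (coeff-neg P r) (coeff-neg Q s) (exponent-< n _ r s n<R))) ⟩
      xsum R (λ r → xsum R (λ s → xsum R (λ i → β s (+ i) ∧ α r (e r s - + i))))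
        ≡⟨ xsum-swap R R _ ⟩
      xsum R (λ s → xsum R (λ r → xsum R (λ i → β s (+ i) ∧ α r (e r s - + i))))
        ≡⟨ xsum-false R (λ s _ → trans (xsum-swap R R _) (xsum-false R (λ i _ → inner s i))) ⟩
      false ∎
      where
      open ≡-Reasoning
      e : ℕ → ℕ → ℤ
      e r s = exponent n (+ suc k - + r + + s) r s
      -- The part of the exponent that does not involve r, after `tri-+` has turned m (k - r) s + m
      -- r s into m k s (with `suc k` for k).
      loss : ℕ → ℕ → ℕ
      loss s i = i ℕ.+ (a ℕ.* suc k ℕ.+ a ℕ.* s ℕ.+ m ℕ.* choose2 s ℕ.+ m ℕ.* suc k ℕ.* s)
      arith : ∀ n i a m k r s t t′ →
        n - (a * (k - r + s) + m * (t + t′ + (k - r) * s)) - m * r * s - i ≡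
        n - (i + (a * k + a * s + m * t′ + m * k * s)) - m * t + a * r
      arith = solve-∀
      shift : ∀ s i r → e r s - + i ≡ + n - + loss s i - + m * tri (+ suc k - + r) + + a * + r
      shift s i r = trans (cong (λ t → + n - (+ a * (+ suc k - + r + + s) + + m * t) - + m * + r * + s - + i)
                            (tri-+ (+ suc k - + r) (+ s)))
        (trans (arith (+ n) (+ i) (+ a) (+ m) (+ suc k) (+ r) (+ s) (tri (+ suc k - + r)) (+ choose2 s))
               (cong (λ z → + n - z - + m * tri (+ suc k - + r) + + a * + r) (sym pos)))
        where
        pos : + loss s i ≡ + i + (+ a * + suc k + + a * + s + + m * + choose2 s + + m * + suc k * + s)
        pos = cong (λ z → + i + z) (cong₂ _+_ (cong₂ _+_ (cong₂ _+_ (ℤ.pos-* a (suc k)) (ℤ.pos-* a s)) (ℤ.pos-* m (choose2 s)))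
          (trans (ℤ.pos-* (m ℕ.* suc k) s) (cong (_* + s) (ℤ.pos-* m (suc k)))))
      -- The term a (k + 1) of `loss` makes up for the summand `suc k` in the hypothesis of
      -- `V-vanishes`, so R > n is enough for every k.
      k<loss : ∀ s i → suc k ≤ loss s i
      k<loss s i = ℕ.≤-trans (ℕ.m≤n*m (suc k) a {{ℕ.>-nonZero 1≤a}})
        (ℕ.≤-trans (ℕ.m≤m+n _ (a ℕ.* s)) (ℕ.≤-trans (ℕ.m≤m+n _ (m ℕ.* choose2 s))
          (ℕ.≤-trans (ℕ.m≤m+n _ (m ℕ.* suc k ℕ.* s)) (ℕ.m≤n+m _ i))))
      small : ∀ s i → + n - + loss s i + + suc k ℤ.< + R
      small s i = ℤ.≤-<-trans (subst (+ n - + loss s i + + suc k ℤ.≤_) (cancel (+ n) (+ loss s i))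
          (ℤ.+-monoʳ-≤ (+ n - + loss s i) (ℤ.+≤+ (k<loss s i)))) (ℤ.+<+ n<R)
        where
        cancel : ∀ n l → n - l + l ≡ n
        cancel = solve-∀
      inner : ∀ s i → xsum R (λ r → β s (+ i) ∧ α r (e r s - + i)) ≡ false
      inner s i = begin
        xsum R (λ r → β s (+ i) ∧ α r (e r s - + i))
          ≡⟨ sym (∧-xsum (β s (+ i)) R _) ⟩
        β s (+ i) ∧ xsum R (λ r → α r (e r s - + i))
          ≡⟨ cong (β s (+ i) ∧_) (xsum-cong R (λ r _ → cong (α r) (shift s i r))) ⟩
        β s (+ i) ∧ V P R (+ suc k) (+ n - + loss s i)
          ≡⟨ cong (β s (+ i) ∧_) (V-vanishes P (subst (1 ≤_) (sym m≡a+b) (ℕ.≤-trans 1≤a (ℕ.m≤m+n a b))) k R (+ n - + loss s i) (small s i)) ⟩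
        β s (+ i) ∧ false
          ≡⟨ ∧-zeroʳ _ ⟩
        false ∎

    -- Here k = 0 and j = s - r. Modulo m the exponents a (s - r) of the theta series, a r of γ and
    -- b s of σ add up to (a + b) s = m s, so only multiples of m occur.
    summand-zero : ∀ n R r s → ¬ m ∣ n → summand R n (+ 0 - + r + + s) r s ≡ false
    summand-zero n R r s m∤n = xsum-false R (λ i _ → ¬-not λ eq →
      let (αi , βi) = ∧-true (α r (+ i)) eq
          (N , p)   = PartSeries.support P r (+ i) αi
          (M , q)   = PartSeries.support Q s _ βi
          z         = tri (+ 0 - + r + + s) + + r * + s + + N + + M + + s
      in m∤n (divides ∣ z ∣ (begin
        n                    ≡⟨ cong ∣_∣ (multiple i N M p q) ⟩
        ∣ + m * z ∣          ≡⟨ ℤ.abs-* (+ m) z ⟩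
        m ℕ.* ∣ z ∣          ≡⟨ ℕ.*-comm m ∣ z ∣ ⟩
        ∣ z ∣ ℕ.* m          ∎)))
      where
      open ≡-Reasoning
      arith₁ : ∀ n T M i → n ≡ T + M + (i + (n - T - M - i))
      arith₁ = solve-∀
      arith₂ : ∀ a b r s t N M → a * (+ 0 - r + s) + (a + b) * t + (a + b) * r * s + ((a * r + (a + b) * N) + (b * s + (a + b) * M))
        ≡ (a + b) * (t + r * s + N + M + s)
      arith₂ = solve-∀
      arith₃ : ∀ a b m r s t N M → m ≡ a + b →
        a * (+ 0 - r + s) + m * t + m * r * s + ((a * r + m * N) + (b * s + m * M)) ≡ m * (t + r * s + N + M + s)
      arith₃ a b m r s t N M refl = arith₂ a b r s t N M
      multiple : ∀ i N M → + i ≡ + a * + r + + m * + N → exponent n (+ 0 - + r + + s) r s - + i ≡ + b * + s + + m * + M →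
        + n ≡ + m * (tri (+ 0 - + r + + s) + + r * + s + + N + + M + + s)
      multiple i N M p q = begin
        + n
          ≡⟨ arith₁ (+ n) (Theta a m (+ 0 - + r + + s)) (+ m * + r * + s) (+ i) ⟩
        Theta a m (+ 0 - + r + + s) + + m * + r * + s + (+ i + (exponent n (+ 0 - + r + + s) r s - + i))
          ≡⟨ cong (λ y → Theta a m (+ 0 - + r + + s) + + m * + r * + s + y) (cong₂ _+_ p q) ⟩
        Theta a m (+ 0 - + r + + s) + + m * + r * + s + ((+ a * + r + + m * + N) + (+ b * + s + + m * + M))
          ≡⟨ arith₃ (+ a) (+ b) (+ m) (+ r) (+ s) (tri (+ 0 - + r + + s)) (+ N) (+ M) (cong +_ m≡a+b) ⟩
        + m * (tri (+ 0 - + r + + s) + + r * + s + + N + + M + + s) ∎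

module _ {a b m : ℕ} (m≡a+b : m ≡ a ℕ.+ b) (1≤a : 1 ≤ a) (1≤b : 1 ≤ b)
         (P : PartSeries a m) (Q : PartSeries b m) where

  open PartSeries P renaming (coeff to α)
  open PartSeries Q renaming (coeff to β)
  private
    module A = Product m≡a+b 1≤a 1≤b
    module B = Product (trans m≡a+b (ℕ.+-comm a b)) 1≤b 1≤a

  -- Exchanging γ with σ, r with s and a with b turns the index -k into k by `Theta-neg`, so this is
  -- the positive case for the mirrored product.
  summand-negative : ∀ n R k → n < R →
    xsum R (λ r → xsum R (λ s → A.summand P Q R n (-[1+ k ] - + r + + s) r s)) ≡ false
  summand-negative n R k n<R = begin
    xsum R (λ r → xsum R (λ s → A.summand P Q R n (-[1+ k ] - + r + + s) r s))
      ≡⟨ xsum-cong R (λ r _ → xsum-cong R (λ s _ → mirror r s)) ⟩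
    xsum R (λ r → xsum R (λ s → B.summand Q P R n (+ suc k - + s + + r) s r))
      ≡⟨ xsum-swap R R (λ r s → B.summand Q P R n (+ suc k - + s + + r) s r) ⟩
    xsum R (λ s → xsum R (λ r → B.summand Q P R n (+ suc k - + s + + r) s r))
      ≡⟨ B.summand-positive Q P n R k n<R ⟩
    false ∎
    where
    open ≡-Reasoning
    arith₁ : ∀ k r s → - k - r + s ≡ - (k - s + r)
    arith₁ = solve-∀
    arith₂ : ∀ n t m r s → n - t - m * r * s ≡ n - t - m * s * r
    arith₂ = solve-∀
    exponents : ∀ r s → A.exponent n (-[1+ k ] - + r + + s) r s ≡ B.exponent n (+ suc k - + s + + r) s r
    exponents r s = trans
      (cong (λ t → + n - t - + m * + r * + s)
        (trans (cong (Theta a m) (arith₁ (+ suc k) (+ r) (+ s))) (Theta-neg a b m≡a+b (+ suc k - + s + + r))))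
      (arith₂ (+ n) (Theta b m (+ suc k - + s + + r)) (+ m) (+ r) (+ s))
    mirror : ∀ r s → A.summand P Q R n (-[1+ k ] - + r + + s) r s ≡ B.summand Q P R n (+ suc k - + s + + r) s r
    mirror r s = trans
      (conv-comm R (α r) (β s) _ (coeff-neg P r) (coeff-neg Q s) (A.exponent-< n _ r s n<R))
      (cong (conv R (β s) (α r)) (exponents r s))

  -- The substitution j = k - r + s is made separately for each r and s. The summands vanish for
  -- absolute values of j above n, and the shift needs room s + 2 r with r, s < R, which explains
  -- the bound on B.
  theta-product : ∀ n R B → n < R → ¬ m ∣ n → suc n ℕ.+ R ℕ.+ R ℕ.+ R ≤ B →
    bisum B (λ j → series P Q R (+ n - Theta a m j)) ≡ false
  theta-product n R B n<R m∤n bound = begin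
    bisum B (λ j → xsum R (λ r → xsum R (λ s → A.summand P Q R n j r s)))
      ≡⟨ bisum-xsum-xsum B R (A.summand P Q R n) ⟩
    xsum R (λ r → xsum R (λ s → bisum B (λ j → A.summand P Q R n j r s)))
      ≡⟨ xsum-cong R (λ r r<R → xsum-cong R (λ s s<R → reindex r s r<R s<R)) ⟩
    xsum R (λ r → xsum R (λ s → bisum B (λ k → A.summand P Q R n (k - + r + + s) r s)))
      ≡⟨ sym (bisum-xsum-xsum B R (λ k r s → A.summand P Q R n (k - + r + + s) r s)) ⟩
    bisum B (λ k → xsum R (λ r → xsum R (λ s → A.summand P Q R n (k - + r + + s) r s)))
      ≡⟨ cong₂ _xor_
           (xsum-false R (λ r _ → xsum-false R (λ s _ → A.summand-zero P Q n R r s m∤n)))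
           (xsum-false B (λ k _ → cong₂ _xor_ (A.summand-positive P Q n R k n<R) (summand-negative n R k n<R))) ⟩
    false ∎
    where
    open ≡-Reasoning
    vanish : ∀ r s → VanishesFrom (suc n) (λ j → A.summand P Q R n j r s)
    vanish r s j n<j = xsum-false R (λ i _ → trans (cong (α r (+ i) ∧_) (coeff-neg Q s _ (below i))) (∧-zeroʳ _))
      where
      below : ∀ i → A.exponent n j r s - + i ℤ.< + 0
      below i = ℤ.≤-<-trans (ℤ.i≤j⇒i-k≤j (+ i) (A.exponent-≤-∣j∣ n j r s))
        (subst (+ n - + ∣ j ∣ ℤ.<_) (ℤ.+-inverseʳ (+ ∣ j ∣)) (ℤ.+-monoˡ-< (- + ∣ j ∣) (ℤ.+<+ n<j)))
    reindex : ∀ r s → r < R → s < R → bisum B (λ j → A.summand P Q R n j r s) ≡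
      bisum B (λ k → A.summand P Q R n (k - + r + + s) r s)
    reindex r s r<R s<R = sym (bisum-shift (suc n) r s B (λ j → A.summand P Q R n j r s) (vanish r s)
      (ℕ.≤-trans (ℕ.+-mono-≤ (ℕ.+-mono-≤ (ℕ.+-monoʳ-≤ (suc n) (ℕ.<⇒≤ s<R)) (ℕ.<⇒≤ r<R)) (ℕ.<⇒≤ r<R)) bound))

-- The parity of `cp`, extended by zero to negative sizes, as a coefficient of the double series.

cpParity : ℕ → ℕ → ℕ → ℤ → Bool
cpParity a b m (+ n)    = parity (cp a b m n)
cpParity a b m -[1+ n ] = false

module Expansion {a b m : ℕ} (1≤a : 1 ≤ a) (a≤m : a ≤ m) (1≤b : 1 ≤ b) (b≤m : b ≤ m) where

  P = partSeries a m 1≤a a≤m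
  Q = partSeries b m 1≤b b≤m
  open PartSeries P renaming (coeff to α)
  open PartSeries Q renaming (coeff to β)

  minus-mrs-≤ : ∀ x r s → x - + m * + r * + s ℤ.≤ x
  minus-mrs-≤ x r s = subst (λ z → x - z ℤ.≤ x) (trans (ℤ.pos-* (m ℕ.* r) s) (cong (_* + s) (ℤ.pos-* m r)))
    (ℤ.i-j≤i x (+ (m ℕ.* r ℕ.* s)))

  -- Once i, r and s are fixed, the `δ` in `parity-cp` determines the size k of σ, and `collapse`
  -- removes the sum over k. The sum over i then extends from n + 1 to R terms, as the new ones have
  -- negative arguments.
  cpParity-series : ∀ R x → x ℤ.< + R → cpParity a b m x ≡ series P Q R x
  cpParity-series R -[1+ n ] _ = sym (xsum-false R (λ r _ → xsum-false R (λ s _ → xsum-false R (λ i _ →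
    trans (cong (α r (+ i) ∧_) (coeff-neg Q s _ (ℤ.≤-<-trans (ℤ.i≤j⇒i-k≤j (+ i) (minus-mrs-≤ -[1+ n ] r s)) ℤ.-<+)))
          (∧-zeroʳ _)))))
  cpParity-series R (+ n) (ℤ.+<+ n<R) = begin
    parity (cp a b m n)
      ≡⟨ parity-cp a b m n R n<R ⟩
    xsum (suc n) (λ i → xsum (suc n) (λ k → xsum R (hit i k)))
      ≡⟨ xsum-cong (suc n) (λ i _ → perI i) ⟩
    xsum (suc n) (λ i → xsum R (λ r → xsum R (λ s → t r s i)))
      ≡⟨ xsum-swap (suc n) R (λ i r → xsum R (λ s → t r s i)) ⟩
    xsum R (λ r → xsum (suc n) (λ i → xsum R (λ s → t r s i)))
      ≡⟨ xsum-cong R (λ r _ → xsum-swap (suc n) R (λ i s → t r s i)) ⟩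
    xsum R (λ r → xsum R (λ s → xsum (suc n) (t r s)))
      ≡⟨ xsum-cong R (λ r _ → xsum-cong R (λ s _ → extend r s)) ⟩
    series P Q R (+ n) ∎
    where
    open ≡-Reasoning
    t : ℕ → ℕ → ℕ → Bool
    t r s i = α r (+ i) ∧ β s (+ n - + m * + r * + s - + i)
    arith : ∀ n i y → n - i - y ≡ n - y - i
    arith = solve-∀
    hit : ℕ → ℕ → ℕ → Bool
    hit i k r = α r (+ i) ∧ xsum R (λ s → β s (+ k) ∧ δ (+ n - + i - + m * + r * + s - + k))
    perIR : ∀ i r → xsum (suc n) (λ k → hit i k r) ≡
      xsum R (λ s → t r s i)
    perIR i r = begin
      xsum (suc n) (λ k → α r (+ i) ∧ xsum R (λ s → d s k))
        ≡⟨ sym (∧-xsum (α r (+ i)) (suc n) (λ k → xsum R (λ s → d s k))) ⟩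
      α r (+ i) ∧ xsum (suc n) (λ k → xsum R (λ s → d s k))
        ≡⟨ cong (α r (+ i) ∧_) (xsum-swap (suc n) R (λ k s → d s k)) ⟩
      α r (+ i) ∧ xsum R (λ s → xsum (suc n) (d s))
        ≡⟨ cong (α r (+ i) ∧_) (xsum-cong R (λ s _ →
             trans (collapse (suc n) (β s) (+ n - + i - + m * + r * + s) (coeff-neg Q s) (below s))
                   (cong (β s) (arith (+ n) (+ i) (+ m * + r * + s))))) ⟩
      α r (+ i) ∧ xsum R (λ s → β s (+ n - + m * + r * + s - + i))
        ≡⟨ ∧-xsum (α r (+ i)) R _ ⟩
      xsum R (λ s → t r s i) ∎
      where
      d : ℕ → ℕ → Bool
      d s k = β s (+ k) ∧ δ (+ n - + i - + m * + r * + s - + k)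
      below : ∀ s → + n - + i - + m * + r * + s ℤ.< + suc n
      below s = ℤ.≤-<-trans (ℤ.≤-trans (minus-mrs-≤ (+ n - + i) r s) (ℤ.i-j≤i (+ n) (+ i))) (ℤ.+<+ ℕ.≤-refl)
    perI : ∀ i → xsum (suc n) (λ k → xsum R (hit i k)) ≡
      xsum R (λ r → xsum R (λ s → t r s i))
    perI i = trans (xsum-swap (suc n) R (hit i)) (xsum-cong R (λ r _ → perIR i r))
    extend : ∀ r s → xsum (suc n) (t r s) ≡ xsum R (t r s)
    extend r s = trans (sym (xsum-extend (suc n) (R ∸ suc n) (t r s) beyond)) (cong (λ z → xsum z (t r s)) (ℕ.m+[n∸m]≡n n<R))
      where
      beyond : ∀ i → suc n ≤ i → t r s i ≡ false
      beyond i n<i = trans (cong (α r (+ i) ∧_) (coeff-neg Q s _ (ℤ.≤-<-trans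
          (ℤ.+-monoˡ-≤ (- + i) (minus-mrs-≤ (+ n) r s))
          (subst (+ n - + i ℤ.<_) (ℤ.+-inverseʳ (+ i)) (ℤ.+-monoˡ-< (- + i) (ℤ.+<+ n<i))))))
        (∧-zeroʳ _)

-- Squares modulo 2, the case a = b, and products of factors 1 + q^i.

δ-double : ∀ x → δ (x + x) ≡ δ x
δ-double (+ zero)  = refl
δ-double (+ suc n) = refl
δ-double -[1+ n ]  = refl

-- The Frobenius identity f(q)^2 = f(q^2) modulo 2: off-diagonal products cancel in pairs.
conv-square : ∀ R f y → (∀ x → x ℤ.< + 0 → f x ≡ false) → y + y ℤ.< + R → conv R f f (y + y) ≡ f y
conv-square R f y f-neg y+y<R = begin
  xsum R (λ i → f (+ i) ∧ f (y + y - + i))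
    ≡⟨ xsum-cong R (λ i _ → cong (f (+ i) ∧_) (sym (collapse R f (y + y - + i) f-neg (below i)))) ⟩
  xsum R (λ i → f (+ i) ∧ xsum R (λ k → f (+ k) ∧ δ (y + y - + i - + k)))
    ≡⟨ xsum-cong R (λ i _ → ∧-xsum (f (+ i)) R _) ⟩
  xsum R (λ i → xsum R (λ k → f (+ i) ∧ (f (+ k) ∧ δ (y + y - + i - + k))))
    ≡⟨ xsum-diagonal R _ (λ i k → trans (∧-left-comm (f (+ i)) (f (+ k)) _)
         (cong (λ z → f (+ k) ∧ (f (+ i) ∧ δ z)) (arith₁ (y + y) (+ i) (+ k)))) ⟩
  xsum R (λ i → f (+ i) ∧ (f (+ i) ∧ δ (y + y - + i - + i)))
    ≡⟨ xsum-cong R (λ i _ → trans (sym (∧-assoc (f (+ i)) (f (+ i)) _)) (cong₂ _∧_ (∧-idem (f (+ i)))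
         (trans (cong δ (arith₂ y (+ i))) (δ-double (y - + i))))) ⟩
  xsum R (λ i → f (+ i) ∧ δ (y - + i))
    ≡⟨ collapse R f y f-neg (y<R y y+y<R) ⟩
  f y ∎
  where
  open ≡-Reasoning
  below : ∀ i → y + y - + i ℤ.< + R
  below i = ℤ.≤-<-trans (ℤ.i-j≤i (y + y) (+ i)) y+y<R
  arith₁ : ∀ x i k → x - i - k ≡ x - k - i
  arith₁ = solve-∀
  arith₂ : ∀ y i → y + y - i - i ≡ (y - i) + (y - i)
  arith₂ = solve-∀
  y<R : ∀ y → y + y ℤ.< + R → y ℤ.< + R
  y<R (+ n)    (ℤ.+<+ n+n<R) = ℤ.+<+ (ℕ.≤-<-trans (ℕ.m≤m+n n n) n+n<R)
  y<R -[1+ n ] _             = ℤ.-<+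

module _ {a m : ℕ} (1≤a : 1 ≤ a) (m≡a+a : m ≡ a ℕ.+ a) where

  private
    a≤m : a ≤ m
    a≤m = subst (a ≤_) (sym m≡a+a) (ℕ.m≤m+n a a)
  open Expansion 1≤a a≤m 1≤a a≤m using (P; cpParity-series; minus-mrs-≤)
  open PartSeries P using () renaming (coeff to α)

  -- For a = b the double series is symmetric in r and s, so only r = s survives, and each remaining
  -- convolution is a square. Halving the exponent leaves m N - a r^2, and m = 2 a gives a r^2 + a r
  -- = m r (r + 1) / 2. The right side is the coefficient of q^(m N) in the sum of q^(m r (r + 1) /
  -- 2) / (q^m; q^m)_r.
  cpParity-double : ∀ N R → m ℕ.* N ℕ.+ m ℕ.* N < R →
    cpParity a a m (+ (m ℕ.* N ℕ.+ m ℕ.* N)) ≡ xsum R (λ r → u P r (+ m * (+ N - + choose2 (suc r))))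
  cpParity-double N R n<R = begin
    cpParity a a m (+ n)
      ≡⟨ cpParity-series R (+ n) (ℤ.+<+ n<R) ⟩
    series P P R (+ n)
      ≡⟨ xsum-diagonal R _ (λ r s → trans
           (conv-comm R (α r) (α s) _ (coeff-neg P r) (coeff-neg P s) (below r s))
           (cong (conv R (α s) (α r)) (arith₁ (+ n) (+ m) (+ r) (+ s)))) ⟩
    xsum R (λ r → conv R (α r) (α r) (+ n - + m * + r * + r))
      ≡⟨ xsum-cong R (λ r _ → trans
           (cong (conv R (α r) (α r)) (half r))
           (conv-square R (α r) (y r) (coeff-neg P r) (subst (ℤ._< + R) (half r) (below r r)))) ⟩
    xsum R (λ r → α r (y r))
      ≡⟨ xsum-cong R (λ r _ → cong (α r) (shift r)) ⟩
    xsum R (λ r → u P r (+ m * (+ N - + choose2 (suc r)))) ∎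
    where
    open ≡-Reasoning
    n = m ℕ.* N ℕ.+ m ℕ.* N
    y : ℕ → ℤ
    y r = + m * + N - + a * + r * + r
    below : ∀ r s → + n - + m * + r * + s ℤ.< + R
    below r s = ℤ.≤-<-trans (minus-mrs-≤ (+ n) r s) (ℤ.+<+ n<R)
    arith₁ : ∀ n m r s → n - m * r * s ≡ n - m * s * r
    arith₁ = solve-∀
    arith₂ : ∀ m N a r → m ≡ a + a → m * N + m * N - m * r * r ≡ (m * N - a * r * r) + (m * N - a * r * r)
    arith₂ m N a r refl = arith a N r
      where
      arith : ∀ a N r → (a + a) * N + (a + a) * N - (a + a) * r * r ≡ ((a + a) * N - a * r * r) + ((a + a) * N - a * r * r)
      arith = solve-∀
    half : ∀ r → + n - + m * + r * + r ≡ y r + y r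
    half r = trans (cong (λ z → z + z - + m * + r * + r) (ℤ.pos-* m N)) (arith₂ (+ m) (+ N) (+ a) (+ r) (cong +_ m≡a+a))
    arith₃ : ∀ m N a r t → m ≡ a + a → + 2 * t ≡ r * (r - + 1) →
      m * N - a * r * r ≡ m * (N - (r + t)) + a * r
    arith₃ m N a r t refl 2t = trans (before a N r) (trans (cong (λ z → (a + a) * N - a * (z + r)) (sym 2t)) (after a N r t))
      where
      before : ∀ a N r → (a + a) * N - a * r * r ≡ (a + a) * N - a * (r * (r - + 1) + r)
      before = solve-∀
      after : ∀ a N r t → (a + a) * N - a * (+ 2 * t + r) ≡ (a + a) * (N - (r + t)) + a * r
      after = solve-∀
    shift : ∀ r → y r ≡ + m * (+ N - + choose2 (suc r)) + + a * + r
    shift r = arith₃ (+ m) (+ N) (+ a) (+ r) (+ choose2 r) (cong +_ m≡a+a) (tri-double (+ r))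

-- The coefficients modulo 2 of ∏ (1 + q^i), the product running over k < i ≤ k + t.
e : ℕ → ℕ → ℤ → Bool
e k zero    x = δ x
e k (suc t) x = e (suc k) t x xor e (suc k) t (x - + suc k)

e-neg : ∀ k t x → x ℤ.< + 0 → e k t x ≡ false
e-neg k zero    x x<0 = δ-≢ x (ℤ.<⇒≢ x<0)
e-neg k (suc t) x x<0 = cong₂ _xor_ (e-neg (suc k) t x x<0)
  (e-neg (suc k) t _ (ℤ.≤-<-trans (ℤ.i≤j⇒i-k≤j (+ suc k) ℤ.≤-refl) x<0))

-- The definition splits off the lowest factor of the product, this the highest.
e-suc : ∀ k t x → e k (suc t) x ≡ e k t x xor e k t (x - + suc (k ℕ.+ t))
e-suc k zero    x = cong (λ n → δ x xor δ (x - + suc n)) (sym (ℕ.+-identityʳ k))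
e-suc k (suc t) x rewrite e-suc (suc k) t x | e-suc (suc k) t (x - + suc k) | ℕ.+-suc k t = trans
  (xor-interchange (e (suc k) t x) _ _ _)
  (cong (λ y → (e (suc k) t x xor e (suc k) t (x - + suc k)) xor (e (suc k) t (x - top) xor e (suc k) t y))
    (arith x (+ suc k) top))
  where
  top = + suc (suc (k ℕ.+ t))
  arith : ∀ x y z → x - y - z ≡ x - z - y
  arith = solve-∀

-- The pentagonal number theorem modulo 2.

antidiagonal : ℕ → (ℕ → ℕ → Bool) → Bool
antidiagonal zero    f = f 0 0
antidiagonal (suc n) f = f 0 (suc n) xor antidiagonal n (λ k t → f (suc k) t)

antidiagonal-cong : ∀ n {f h : ℕ → ℕ → Bool} → (∀ k t → k ℕ.+ t ≡ n → f k t ≡ h k t) →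
  antidiagonal n f ≡ antidiagonal n h
antidiagonal-cong zero    eq = eq 0 0 refl
antidiagonal-cong (suc n) eq = cong₂ _xor_ (eq 0 (suc n) refl) (antidiagonal-cong n (λ k t p → eq (suc k) t (cong suc p)))

antidiagonal-xor : ∀ n (f h : ℕ → ℕ → Bool) →
  antidiagonal n (λ k t → f k t xor h k t) ≡ antidiagonal n f xor antidiagonal n h
antidiagonal-xor zero    f h = refl
antidiagonal-xor (suc n) f h = trans (cong ((f 0 (suc n) xor h 0 (suc n)) xor_) (antidiagonal-xor n _ _))
                                     (xor-interchange (f 0 (suc n)) (h 0 (suc n)) _ _)

antidiagonal-last : ∀ n f → antidiagonal (suc n) f ≡ antidiagonal n (λ k t → f k (suc t)) xor f (suc n) 0
antidiagonal-last zero    f = refl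
antidiagonal-last (suc n) f = trans (cong (f 0 (suc (suc n)) xor_) (antidiagonal-last n (λ k t → f (suc k) t)))
                                    (sym (xor-assoc (f 0 (suc (suc n))) _ _))

antidiagonal-false : ∀ n {f : ℕ → ℕ → Bool} → (∀ k t → k ℕ.+ t ≡ n → f k t ≡ false) → antidiagonal n f ≡ false
antidiagonal-false zero    eq = eq 0 0 refl
antidiagonal-false (suc n) eq = cong₂ _xor_ (eq 0 (suc n) refl) (antidiagonal-false n (λ k t p → eq (suc k) t (cong suc p)))

-- The generalised pentagonal numbers j (3j - 1) / 2 and j (3j + 1) / 2.
pent⁻ pent⁺ : ℕ → ℕ
pent⁻ j = j ℕ.* j ℕ.+ choose2 j
pent⁺ j = j ℕ.* j ℕ.+ choose2 (suc j)

-- Shanks' truncation of the pentagonal number series.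
shanks : ℕ → ℤ → Bool
shanks n x = antidiagonal n (λ k t → e k t (x - + n * + k - + choose2 (suc k)))

-- Splitting off the factor 1 + q^(n + 1) writes the left side as p + q, plus the new term k = n +
-- 1, which is `δ⁺`. With s the terms of `shanks n`, the term k + 1 of p + s is the term k of q and
-- its term 0 vanishes; so p + s is q without its last term `δ⁻`, and q cancels.
shanks-suc : ∀ n x → shanks (suc n) x ≡ shanks n x xor (δ (x - + pent⁻ (suc n)) xor δ (x - + pent⁺ (suc n)))
shanks-suc n x = begin
  shanks (suc n) x
    ≡⟨ antidiagonal-last n p ⟩
  antidiagonal n (λ k t → e k (suc t) (y k)) xor δ (y (suc n))
    ≡⟨ cong₂ _xor_ (trans (antidiagonal-cong n (λ k t k+t≡n → trans (e-suc k t (y k)) (cong (λ i → p k t xor e k t (y k - + suc i)) k+t≡n)))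
                          (antidiagonal-xor n p q))
                   (cong δ (arith⁺ n x)) ⟩
  (antidiagonal n p xor antidiagonal n q) xor δ⁺
    ≡⟨ cong (λ z → (z xor antidiagonal n q) xor δ⁺) p≡ ⟩
  ((shanks n x xor (antidiagonal n q xor δ⁻)) xor antidiagonal n q) xor δ⁺
    ≡⟨ rearrange (shanks n x) (antidiagonal n q) δ⁻ δ⁺ ⟩
  shanks n x xor (δ⁻ xor δ⁺) ∎
  where
  open ≡-Reasoning
  y : ℕ → ℤ
  y k = x - + suc n * + k - + choose2 (suc k)
  p q s : ℕ → ℕ → Bool
  p k t = e k t (y k)
  q k t = e k t (y k - + suc n)
  s k t = e k t (x - + n * + k - + choose2 (suc k))
  δ⁻ = δ (x - + pent⁻ (suc n))
  δ⁺ = δ (x - + pent⁺ (suc n))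
  rearrange : ∀ a b c d → ((a xor (b xor c)) xor b) xor d ≡ a xor (c xor d)
  rearrange false false c d = cong (_xor d) (xor-identityʳ c)
  rearrange false true false d = refl
  rearrange false true true d = refl
  rearrange true false false d = refl
  rearrange true false true d = sym (not-involutive d)
  rearrange true true false d = refl
  rearrange true true true d = sym (not-involutive d)
  arith₁ : ∀ x N t → x - N * N - t ≡ x - (N * N + t)
  arith₁ = solve-∀
  arith⁺ : ∀ n x → x - + suc n * + suc n - + choose2 (suc (suc n)) ≡ x - + pent⁺ (suc n)
  arith⁺ n x = arith₁ x (+ suc n) (+ choose2 (suc (suc n)))
  arith₂ : ∀ x n t → x - (+ 1 + n) * n - t - (+ 1 + n) ≡ x - ((+ 1 + n) * (+ 1 + n) + t)
  arith₂ = solve-∀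
  q-last : q n 0 ≡ δ⁻
  q-last = cong δ (arith₂ x (+ n) (+ choose2 (suc n)))
  arith₃ : ∀ x n k t → x - (+ 1 + n) * (+ 1 + k) - ((+ 1 + k) + t) ≡ x - n * (+ 1 + k) - ((+ 1 + k) + t) - (+ 1 + k)
  arith₃ = solve-∀
  arith₄ : ∀ x n k t → x - n * (+ 1 + k) - ((+ 1 + k) + t) ≡ x - (+ 1 + n) * k - t - (+ 1 + n)
  arith₄ = solve-∀
  arith₅ : ∀ x n → x - (+ 1 + n) * + 0 ≡ x - n * + 0
  arith₅ = solve-∀
  -- The two arguments differ by k + 1, so the sum restores the factor 1 + q^(k + 1).
  step : ∀ k t → p (suc k) t xor s (suc k) t ≡ q k (suc t)
  step k t = trans (cong (λ z → e (suc k) t z xor s (suc k) t) (arith₃ x (+ n) (+ k) (+ choose2 (suc k))))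
    (trans (xor-comm _ (s (suc k) t)) (cong (e k (suc t)) (arith₄ x (+ n) (+ k) (+ choose2 (suc k)))))
  head : ∀ t → p 0 t xor s 0 t ≡ false
  head t = trans (cong (λ z → e 0 t (z - + 0) xor s 0 t) (arith₅ x (+ n))) (xor-same (s 0 t))
  p⊕s : ∀ i → i ≡ n → antidiagonal i (λ k t → p k t xor s k t) ≡ antidiagonal i q xor q i 0
  p⊕s zero    i≡n = trans (head 0) (sym (xor-same (q 0 0)))
  p⊕s (suc i) i≡n = begin
    (p 0 (suc i) xor s 0 (suc i)) xor antidiagonal i (λ k t → p (suc k) t xor s (suc k) t)
      ≡⟨ cong₂ _xor_ (head (suc i)) (antidiagonal-cong i (λ k t _ → step k t)) ⟩
    antidiagonal i (λ k t → q k (suc t))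
      ≡⟨ sym (xor-identityʳ _) ⟩
    antidiagonal i (λ k t → q k (suc t)) xor false
      ≡⟨ cong (antidiagonal i (λ k t → q k (suc t)) xor_) (sym (xor-same (q (suc i) 0))) ⟩
    antidiagonal i (λ k t → q k (suc t)) xor (q (suc i) 0 xor q (suc i) 0)
      ≡⟨ sym (xor-assoc (antidiagonal i (λ k t → q k (suc t))) _ _) ⟩
    (antidiagonal i (λ k t → q k (suc t)) xor q (suc i) 0) xor q (suc i) 0
      ≡⟨ cong (_xor q (suc i) 0) (sym (antidiagonal-last i q)) ⟩
    antidiagonal (suc i) q xor q (suc i) 0 ∎
  p≡ : antidiagonal n p ≡ shanks n x xor (antidiagonal n q xor δ⁻)
  p≡ = begin
    antidiagonal n p
      ≡⟨ sym (cong (_xor antidiagonal n p) (xor-same (shanks n x))) ⟩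
    (shanks n x xor shanks n x) xor antidiagonal n p
      ≡⟨ xor-assoc (shanks n x) (shanks n x) _ ⟩
    shanks n x xor (shanks n x xor antidiagonal n p)
      ≡⟨ cong (shanks n x xor_) (trans (xor-comm (shanks n x) _) (sym (antidiagonal-xor n p s))) ⟩
    shanks n x xor antidiagonal n (λ k t → p k t xor s k t)
      ≡⟨ cong (shanks n x xor_) (trans (p⊕s n refl) (cong (antidiagonal n q xor_) q-last)) ⟩
    shanks n x xor (antidiagonal n q xor δ⁻) ∎

shanks-pentagonal : ∀ n x → shanks n x ≡ δ x xor xsum n (λ i → δ (x - + pent⁻ (suc i)) xor δ (x - + pent⁺ (suc i)))
shanks-pentagonal zero    x = trans (cong δ (arith x)) (sym (xor-identityʳ (δ x)))
  where
  arith : ∀ x → x - + 0 * + 0 - + 0 ≡ x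
  arith = solve-∀
shanks-pentagonal (suc n) x = trans (shanks-suc n x) (trans
  (cong (_xor (δ (x - + pent⁻ (suc n)) xor δ (x - + pent⁺ (suc n)))) (shanks-pentagonal n x))
  (trans (xor-assoc (δ x) _ _) (cong (δ x xor_) (sym (xsum-last n (λ i → δ (x - + pent⁻ (suc i)) xor δ (x - + pent⁺ (suc i))))))))

-- Terms with k ≥ 1 start at exponent n k + k (k + 1) / 2, which is greater than n; only k = 0
-- contributes.
shanks-e : ∀ n x → x ℤ.≤ + n → shanks n x ≡ e 0 n x
shanks-e n x x≤n = trans (split n refl) (cong (e 0 n) (arith x (+ n)))
  where
  arith : ∀ x n → x - n * + 0 - + 0 ≡ x
  arith = solve-∀
  tail : ∀ k t → e (suc k) t (x - + n * + suc k - + choose2 (suc (suc k))) ≡ false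
  tail k t = e-neg (suc k) t _ (ℤ.≤-<-trans (ℤ.+-monoˡ-≤ (- + choose2 (suc (suc k))) (ℤ.+-monoˡ-≤ (- (+ n * + suc k)) x≤n))
    (subst (λ z → + n - z - + choose2 (suc (suc k)) ℤ.< + 0) (ℤ.pos-* n (suc k))
      (subst (ℤ._< + 0) (sym (arith₂ (+ n) (+ (n ℕ.* suc k)) (+ choose2 (suc (suc k)))))
        (subst (+ n - + (n ℕ.* suc k ℕ.+ choose2 (suc (suc k))) ℤ.<_) (ℤ.+-inverseʳ (+ n))
          (ℤ.+-monoʳ-< (+ n) (ℤ.neg-mono-< (ℤ.+<+ (ℕ.≤-<-trans (ℕ.m≤m*n n (suc k)) (ℕ.m<m+n (n ℕ.* suc k) (s≤s z≤n))))))))))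
    where
    arith₂ : ∀ n y z → n - y - z ≡ n - (y + z)
    arith₂ = solve-∀
  split : ∀ i → i ≡ n → antidiagonal i (λ k t → e k t (x - + n * + k - + choose2 (suc k))) ≡ e 0 i (x - + n * + 0 - + 0)
  split zero    _ = refl
  split (suc i) _ = trans (cong (e 0 (suc i) (x - + n * + 0 - + 0) xor_) (antidiagonal-false i (λ k t _ → tail k t)))
                          (xor-identityʳ _)

choose2-mono : ∀ {p q} → p ≤ q → choose2 p ≤ choose2 q
choose2-mono z≤n       = z≤n
choose2-mono (s≤s p≤q) = ℕ.+-mono-≤ p≤q (choose2-mono p≤q)

pent⁻≤pent⁺ : ∀ p → pent⁻ p ≤ pent⁺ p
pent⁻≤pent⁺ p = ℕ.+-monoʳ-≤ (p ℕ.* p) (ℕ.m≤n+m (choose2 p) p)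

pent⁺<pent⁻ : ∀ {p q} → p < q → pent⁺ p < pent⁻ q
pent⁺<pent⁻ p<q = ℕ.+-mono-<-≤ (ℕ.*-mono-< p<q p<q) (choose2-mono p<q)

-- Truncating at the pentagonal number itself is enough for `shanks-e`. The generalised pentagonal
-- numbers are strictly ordered, so exactly one `δ` is hit.
e-pentagonal : ∀ j → e 0 (pent⁻ (suc j)) (+ pent⁻ (suc j)) ≡ true
e-pentagonal j = begin
  e 0 n (+ n)
    ≡⟨ sym (shanks-e n (+ n) ℤ.≤-refl) ⟩
  shanks n (+ n)
    ≡⟨ shanks-pentagonal n (+ n) ⟩
  xsum n (λ i → δ (+ n - + pent⁻ (suc i)) xor δ (+ n - + pent⁺ (suc i)))
    ≡⟨ xsum-single n j j<n others ⟩
  δ (+ n - + n) xor δ (+ n - + pent⁺ (suc j))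
    ≡⟨ cong₂ _xor_ (cong δ (ℤ.+-inverseʳ (+ n))) (miss (ℕ.<⇒≢ n<pent⁺)) ⟩
  true ∎
  where
  open ≡-Reasoning
  n = pent⁻ (suc j)
  j<n : j < n
  j<n = ℕ.≤-trans (ℕ.m≤m*n (suc j) (suc j)) (ℕ.m≤m+n _ (choose2 (suc j)))
  n<pent⁺ : n < pent⁺ (suc j)
  n<pent⁺ = ℕ.+-monoʳ-< (suc j ℕ.* suc j) (ℕ.m<n+m (choose2 (suc j)) {suc j} (s≤s z≤n))
  miss : ∀ {k} → ¬ n ≡ k → δ (+ n - + k) ≡ false
  miss {k} n≢k = δ-≢ _ (λ eq → n≢k (ℤ.+-injective (ℤ.i-j≡0⇒i≡j (+ n) (+ k) eq)))
  others : ∀ i → i < n → ¬ i ≡ j → δ (+ n - + pent⁻ (suc i)) xor δ (+ n - + pent⁺ (suc i)) ≡ false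
  others i _ i≢j with ℕ.<-cmp i j
  ... | tri< i<j _ _ = cong₂ _xor_ (miss (ℕ.>⇒≢ (ℕ.≤-<-trans (pent⁻≤pent⁺ (suc i)) lt))) (miss (ℕ.>⇒≢ lt))
    where lt = pent⁺<pent⁻ (s≤s i<j)
  ... | tri≈ _ i≡j _ = contradiction i≡j i≢j
  ... | tri> _ _ j<i = cong₂ _xor_ (miss (ℕ.<⇒≢ lt)) (miss (ℕ.<⇒≢ (ℕ.<-≤-trans lt (pent⁻≤pent⁺ (suc i)))))
    where lt = ℕ.≤-<-trans (pent⁻≤pent⁺ (suc j)) (pent⁺<pent⁻ (s≤s j<i))

-- Euler's expansion of the product of 1 + q^i by the number of factors used.

module _ {a m : ℕ} (P : PartSeries a m) (1≤m : 1 ≤ m) where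

  -- Truncations of ∏_{i > d} (1 + q^i) as the sum of q^(r (r + 1) / 2 + r d) / (q; q)_r over r.
  w : ℕ → ℕ → ℤ → Bool
  w R d x = xsum R (λ r → u P r (+ m * (x - + choose2 (suc r) - + r * + d)))

  -- The factor i = d + 1 is split off, up to truncation; termwise this is `u-suc`.
  w-suc : ∀ R d x → w (suc R) d x ≡ w (suc R) (suc d) x xor w R (suc d) (x - + suc d)
  w-suc R d x = begin
    u P 0 (+ m * (x - + 0 - + 0)) xor xsum R (λ r → u P (suc r) (v r d))
      ≡⟨ cong (u P 0 (+ m * (x - + 0 - + 0)) xor_) (trans (xsum-cong R (λ r _ → split r)) (xsum-xor R _ _)) ⟩
    u P 0 (+ m * (x - + 0 - + 0)) xor (xsum R (λ r → u P (suc r) (v r (suc d))) xor w R (suc d) (x - + suc d))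
      ≡⟨ sym (xor-assoc (u P 0 (+ m * (x - + 0 - + 0))) _ _) ⟩
    w (suc R) (suc d) x xor w R (suc d) (x - + suc d) ∎
    where
    open ≡-Reasoning
    v : ℕ → ℕ → ℤ
    v r d = + m * (x - + choose2 (suc (suc r)) - + suc r * + d)
    arith₁ : ∀ m x t r d → m * (x - t - r * d) - m * r ≡ m * (x - t - r * (+ 1 + d))
    arith₁ = solve-∀
    arith₂ : ∀ m x t r d → m * (x - ((+ 1 + r) + t) - (+ 1 + r) * d) ≡ m * (x - (+ 1 + d) - t - r * (+ 1 + d))
    arith₂ = solve-∀
    split : ∀ r → u P (suc r) (v r d) ≡
      u P (suc r) (v r (suc d)) xor u P r (+ m * (x - + suc d - + choose2 (suc r) - + r * + suc d))
    split r = trans (u-suc P r (v r d)) (trans (xor-comm (u P r (v r d)) _)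
      (cong₂ (λ y z → u P (suc r) y xor u P r z)
        (arith₁ (+ m) x (+ choose2 (suc (suc r))) (+ suc r) (+ d)) (arith₂ (+ m) x (+ choose2 (suc r)) (+ r) (+ d))))

  private
    pos-*-neg : ∀ m x → 1 ≤ m → x ℤ.< + 0 → + m * x ℤ.< + 0
    pos-*-neg (suc m) -[1+ n ] _ _ = ℤ.-<+
    pos-*-neg (suc m) (+ n) _ (ℤ.+<+ ())

    δ-* : ∀ m x → 1 ≤ m → δ (+ m * x) ≡ δ x
    δ-* (suc m) (+ zero)  _ = cong δ (ℤ.*-zeroʳ (+ suc m))
    δ-* (suc m) (+ suc n) _ = refl
    δ-* (suc m) -[1+ n ]  _ = refl

  -- Both sides lose the factor k + 1 at each step, and R may drop by one, hence t < R. At t = 0 the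
  -- hypothesis reads x ≤ k, while every term with r ≥ 1 starts at r (r + 1) / 2 + r k > k, so only
  -- r = 0 remains.
  w-e : ∀ t k R x → t < R → x ℤ.≤ + (k ℕ.+ t) → w R k x ≡ e k t x
  w-e (suc t) k (suc R) x (s≤s t<R) x≤ = trans (w-suc R k x) (cong₂ _xor_
    (w-e t (suc k) (suc R) x (ℕ.m<n⇒m<1+n t<R) x≤′)
    (w-e t (suc k) R (x - + suc k) t<R (ℤ.i≤j⇒i-k≤j (+ suc k) x≤′)))
    where x≤′ = subst (λ n → x ℤ.≤ + n) (ℕ.+-suc k t) x≤
  w-e zero k (suc R) x _ x≤ = begin
    u P 0 (+ m * (x - + 0 - + 0)) xor xsum R (λ r → u P (suc r) (v r))
      ≡⟨ cong₂ _xor_ (trans (u-zero P _) (trans (δ-* m _ 1≤m) (cong δ (arith x)))) (xsum-false R (λ r _ → u-neg P (suc r) (v r) (v<0 r))) ⟩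
    δ x xor false
      ≡⟨ xor-identityʳ (δ x) ⟩
    δ x ∎
    where
    open ≡-Reasoning
    arith : ∀ x → x - + 0 - + 0 ≡ x
    arith = solve-∀
    arith₂ : ∀ k y z → k - y - z ≡ k - (y + z)
    arith₂ = solve-∀
    v : ℕ → ℤ
    v r = + m * (x - + choose2 (suc (suc r)) - + suc r * + k)
    v<0 : ∀ r → v r ℤ.< + 0
    v<0 r = pos-*-neg m _ 1≤m (ℤ.≤-<-trans (ℤ.+-monoˡ-≤ (- (+ suc r * + k))
        (ℤ.+-monoˡ-≤ (- + choose2 (suc (suc r))) (subst (λ n → x ℤ.≤ + n) (ℕ.+-identityʳ k) x≤)))
      (subst (λ z → + k - + choose2 (suc (suc r)) - z ℤ.< + 0) (ℤ.pos-* (suc r) k)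
        (subst (ℤ._< + 0) (sym (arith₂ (+ k) (+ choose2 (suc (suc r))) (+ (suc r ℕ.* k))))
          (subst (+ k - + (choose2 (suc (suc r)) ℕ.+ suc r ℕ.* k) ℤ.<_) (ℤ.+-inverseʳ (+ k))
            (ℤ.+-monoʳ-< (+ k) (ℤ.neg-mono-< (ℤ.+<+ (ℕ.≤-<-trans (ℕ.m≤n*m k (suc r))
              (ℕ.m<n+m (suc r ℕ.* k) {choose2 (suc (suc r))} (s≤s z≤n))))))))))

-- From the theta relation to infinitely many values of each parity.

parity-*2 : ∀ q → parity (q ℕ.* 2) ≡ false
parity-*2 zero    = refl
parity-*2 (suc q) = trans (not-involutive _) (parity-*2 q)

parity-false⇒2∣ : ∀ n → parity n ≡ false → 2 ∣ n
parity-false⇒2∣ zero          _  = divides 0 refl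
parity-false⇒2∣ (suc (suc n)) eq with parity-false⇒2∣ n (trans (sym (not-involutive _)) eq)
... | divides q n≡q*2 = divides (suc q) (cong (2 ℕ.+_) n≡q*2)

parity-true⇒2∤ : ∀ n → parity n ≡ true → ¬ 2 ∣ n
parity-true⇒2∤ .(q ℕ.* 2) eq (divides q refl) with trans (sym eq) (parity-*2 q)
... | ()

-- Constructive replacement for assuming that f is eventually false: a window long enough for one
-- instance of the theta relation suffices.
search : (f : ℕ → Bool) (N len : ℕ) →
  (∃[ n ] N ≤ n × f n ≡ true) ⊎ (∀ n → N ≤ n → n < N ℕ.+ len → f n ≡ false)
search f N zero = inj₂ (λ n N≤n n<N+0 → contradiction N≤n (ℕ.<⇒≱ (subst (n <_) (ℕ.+-identityʳ N) n<N+0)))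
search f N (suc len) with f N in eq | search f (suc N) len
... | true  | _               = inj₁ (N , ℕ.≤-refl , eq)
... | false | inj₁ (n , p , q) = inj₁ (n , ℕ.<⇒≤ p , q)
... | false | inj₂ none        = inj₂ λ n N≤n n< → case-≤ n N≤n (subst (n <_) (ℕ.+-suc N len) n<)
  where
  case-≤ : ∀ n → N ≤ n → n < suc N ℕ.+ len → f n ≡ false
  case-≤ n N≤n n< with ℕ.m≤n⇒m<n∨m≡n N≤n
  ... | inj₁ N<n  = none n N<n n<
  ... | inj₂ refl = eq

-- `Theta` at natural indices; by `Theta-neg` its values at negative indices are `theta b m`.
theta : ℕ → ℕ → ℕ → ℕ
theta a m j = a ℕ.* j ℕ.+ m ℕ.* choose2 j

theta-mono : ∀ a m {i j} → i ≤ j → theta a m i ≤ theta a m j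
theta-mono a m i≤j = ℕ.+-mono-≤ (ℕ.*-monoʳ-≤ a i≤j) (ℕ.*-monoʳ-≤ m (choose2-mono i≤j))

theta-monoˡ : ∀ {a b} m j → a ≤ b → theta a m j ≤ theta b m j
theta-monoˡ m j a≤b = ℕ.+-monoˡ-≤ (m ℕ.* choose2 j) (ℕ.*-monoˡ-≤ j a≤b)

-- F times the theta series is, modulo 2, supported on multiples of m.
ThetaRelation : ℕ → ℕ → ℕ → (ℤ → Bool) → Set
ThetaRelation c d m F = ∀ n → ¬ m ∣ n → ∃[ B ] n ≤ B ×
  F (+ n) xor xsum B (λ i → F (+ n - + theta c m (suc i)) xor F (+ n - + theta d m (suc i))) ≡ false

ThetaRelation-sym : ∀ {c d m F} → ThetaRelation c d m F → ThetaRelation d c m F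
ThetaRelation-sym {c} {d} {m} {F} rel n m∤n with rel n m∤n
... | B , n≤B , eq = B , n≤B , trans (cong (F (+ n) xor_) (xsum-cong B (λ i _ → xor-comm (F (+ n - + theta d m (suc i))) _))) eq

cp-ThetaRelation : ∀ {a b m} → m ≡ a ℕ.+ b → 1 ≤ a → 1 ≤ b → ThetaRelation a b m (cpParity a b m)
cp-ThetaRelation {a} {b} {m} m≡a+b 1≤a 1≤b n m∤n = B , ℕ.≤-trans n≤3R (ℕ.m≤n+m (R ℕ.+ R ℕ.+ R) R) , (begin
  F (+ n) xor xsum B (λ i → F (+ n - + theta a m (suc i)) xor F (+ n - + theta b m (suc i)))
    ≡⟨ cong₂ _xor_ (cong F centre) (xsum-cong B (λ i _ → cong₂ _xor_ (cong F (right i)) (cong F (left i)))) ⟩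
  bisum B (λ j → F (+ n - Theta a m j))
    ≡⟨ bisum-cong B (λ j → cpParity-series R (+ n - Theta a m j) (below j)) ⟩
  bisum B (λ j → series P Q R (+ n - Theta a m j))
    ≡⟨ theta-product m≡a+b 1≤a 1≤b P Q n R B ℕ.≤-refl m∤n (ℕ.≤-reflexive (reassoc R)) ⟩
  false ∎)
  where
  open ≡-Reasoning
  a≤m = subst (a ≤_) (sym m≡a+b) (ℕ.m≤m+n a b)
  b≤m = subst (b ≤_) (sym m≡a+b) (ℕ.m≤n+m b a)
  open Expansion 1≤a a≤m 1≤b b≤m
  F = cpParity a b m
  R = suc n
  -- The least B that `theta-product` admits for R = n + 1.
  B = R ℕ.+ (R ℕ.+ R ℕ.+ R)
  n≤3R : n ≤ R ℕ.+ R ℕ.+ R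
  n≤3R = ℕ.≤-trans (ℕ.n≤1+n n) (ℕ.m≤n+m R (R ℕ.+ R))
  reassoc : ∀ R → R ℕ.+ R ℕ.+ R ℕ.+ R ≡ R ℕ.+ (R ℕ.+ R ℕ.+ R)
  reassoc R = trans (cong (ℕ._+ R) (ℕ.+-assoc R R R)) (ℕ.+-assoc R (R ℕ.+ R) R)
  centre : + n ≡ + n - Theta a m (+ 0)
  centre = arith (+ n) (+ a) (+ m)
    where
    arith : ∀ n a m → n ≡ n - (a * + 0 + m * + 0)
    arith = solve-∀
  right : ∀ i → + n - + theta a m (suc i) ≡ + n - Theta a m (+ suc i)
  right i = cong (λ z → + n - z) (sym (Theta-pos a m (suc i)))
  left : ∀ i → + n - + theta b m (suc i) ≡ + n - Theta a m -[1+ i ]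
  left i = cong (λ z → + n - z) (sym (trans (Theta-neg a b m≡a+b (+ suc i)) (Theta-pos b m (suc i))))
  below : ∀ j → + n - Theta a m j ℤ.< + R
  below j = ℤ.≤-<-trans (ℤ.≤-trans (ℤ.+-monoʳ-≤ (+ n) (ℤ.neg-mono-≤ (∣j∣≤Theta m≡a+b 1≤a 1≤b j))) (ℤ.i-j≤i (+ n) (+ ∣ j ∣)))
                        (ℤ.+<+ ℕ.≤-refl)

module _ {c d m : ℕ} (m≡c+d : m ≡ c ℕ.+ d) (1≤c : 1 ≤ c) (c≤d : c ≤ d)
         (F : ℤ → Bool) (F-neg : ∀ n → F -[1+ n ] ≡ false) (rel : ThetaRelation c d m F) where

  private
    F-minus-< : ∀ {n k} → n < k → F (+ n - + k) ≡ false
    F-minus-< {n} {k} n<k = trans (cong F (trans (ℤ.m-n≡m⊖n n k) (ℤ.⊖-< n<k))) (neg (k ∸ n) (ℕ.m<n⇒0<n∸m n<k))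
      where
      neg : ∀ x → 0 < x → F (- + x) ≡ false
      neg (suc x) _ = F-neg x

    F-minus-≥ : ∀ n N k v → (∀ x → N ≤ x → x < N ℕ.+ suc n → F (+ x) ≡ v) → k ℕ.+ N ≤ n → F (+ n - + k) ≡ v
    F-minus-≥ n N k v const k+N≤n = trans (cong F (trans (ℤ.m-n≡m⊖n n k) (ℤ.⊖-≥ (ℕ.m+n≤o⇒m≤o k k+N≤n))))
      (const (n ∸ k) (ℕ.m+n≤o⇒m≤o∸n N (subst (_≤ n) (ℕ.+-comm k N) k+N≤n))
        (ℕ.<-≤-trans (s≤s (ℕ.m∸n≤m n k)) (ℕ.m≤n+m (suc n) N)))

    m∣theta-rest : ∀ x j y → m ∣ y → m ∣ j → m ∣ theta x m j ℕ.+ y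
    m∣theta-rest x j y m∣y m∣j = ∣.∣m∣n⇒∣m+n (∣.∣m∣n⇒∣m+n (∣.∣n⇒∣m*n x m∣j) (∣.m∣m*n (choose2 j))) m∣y

    1<m : 1 < m
    1<m = subst (1 <_) (sym m≡c+d) (ℕ.+-mono-≤ 1≤c (ℕ.≤-trans 1≤c c≤d))

    theta-suc : ∀ x j → theta x m (suc j) ≡ x ℕ.* suc j ℕ.+ m ℕ.* j ℕ.+ m ℕ.* choose2 j
    theta-suc x j = trans (cong (x ℕ.* suc j ℕ.+_) (ℕ.*-distribˡ-+ m j (choose2 j))) (sym (ℕ.+-assoc (x ℕ.* suc j) (m ℕ.* j) _))

    -- The room between the larger exponent at j and the smaller one at j + 1 grows without bound,
    -- so the arguments of `F` that stay nonnegative can be kept beyond N.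
    theta-gap : ∀ j → theta d m j ℕ.+ suc j ≤ theta c m (suc j)
    theta-gap j = begin
      d ℕ.* j ℕ.+ m ℕ.* choose2 j ℕ.+ suc j       ≡⟨ trans (ℕ.+-comm _ (suc j)) (sym (ℕ.+-assoc (suc j) (d ℕ.* j) _)) ⟩
      suc j ℕ.+ d ℕ.* j ℕ.+ m ℕ.* choose2 j       ≤⟨ ℕ.+-monoˡ-≤ (m ℕ.* choose2 j) (ℕ.+-mono-≤ (ℕ.m≤n*m (suc j) c {{ℕ.>-nonZero 1≤c}})
                                                  (ℕ.*-monoˡ-≤ j (subst (d ≤_) (sym m≡c+d) (ℕ.m≤n+m d c)))) ⟩
      c ℕ.* suc j ℕ.+ m ℕ.* j ℕ.+ m ℕ.* choose2 j ≡⟨ sym (theta-suc c j) ⟩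
      theta c m (suc j)                      ∎
      where open ℕ.≤-Reasoning

  -- If `F` were true throughout the window, each pair with i < j would give 1 + 1 and each later
  -- pair 0 + 0. Only `F (+ n)` would remain, making the sum odd.
  infinitely-often-false : ∀ N → ∃[ n ] N ≤ n × F (+ n) ≡ false
  infinitely-often-false N with search (λ x → not (F (+ x))) N (suc (theta d m (m ℕ.* suc N) ℕ.+ suc (m ℕ.* N)))
  ... | inj₁ (n , N≤n , eq) = n , N≤n , trans (sym (not-involutive _)) (cong not eq)
  ... | inj₂ none = contradiction (trans (sym total) (proj₂ (proj₂ (rel n m∤n)))) (λ ())
    where
    -- As m divides j, it divides `theta d m j`, so n is 1 modulo m. The offset m N + 1 is at least
    -- N, which keeps all arguments beyond N, and at most j, which keeps n below the next exponent.
    j = m ℕ.* suc N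
    n = theta d m j ℕ.+ suc (m ℕ.* N)
    const : ∀ x → N ≤ x → x < N ℕ.+ suc n → F (+ x) ≡ true
    const x N≤x x< = trans (sym (not-involutive _)) (cong not (none x N≤x x<))
    N≤mN+1 : N ≤ suc (m ℕ.* N)
    N≤mN+1 = ℕ.m≤n⇒m≤1+n (ℕ.m≤n*m N m {{ℕ.>-nonZero (ℕ.<⇒≤ 1<m)}})
    m∤n : ¬ m ∣ n
    m∤n m∣n = ℕ.<⇒≢ 1<m (sym (∣.∣1⇒≡1 (∣.∣m+n∣m⇒∣n
      (subst (m ∣_) (trans (cong (theta d m j ℕ.+_) (ℕ.+-comm 1 (m ℕ.* N))) (sym (ℕ.+-assoc (theta d m j) (m ℕ.* N) 1))) m∣n)
      (m∣theta-rest d j (m ℕ.* N) (∣.m∣m*n N) (∣.m∣m*n (suc N))))))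
    n<theta : ∀ i → j ≤ i → n < theta c m (suc i)
    n<theta i j≤i = ℕ.<-≤-trans (ℕ.+-monoʳ-< (theta d m j) (s≤s mN<j)) (ℕ.≤-trans (theta-gap j) (theta-mono c m (s≤s j≤i)))
      where
      mN<j : m ℕ.* N < j
      mN<j = ℕ.*-monoʳ-< m {{ℕ.>-nonZero (ℕ.<⇒≤ 1<m)}} ℕ.≤-refl
    theta-≤ : ∀ i → i < j → theta d m (suc i) ℕ.+ N ≤ n
    theta-≤ i i<j = ℕ.+-mono-≤ (theta-mono d m i<j) N≤mN+1
    pair : ∀ i → F (+ n - + theta c m (suc i)) xor F (+ n - + theta d m (suc i)) ≡ false
    pair i with ℕ.<-≤-connex i j
    ... | inj₁ i<j = cong₂ _xor_
      (F-minus-≥ n N _ true const (ℕ.≤-trans (ℕ.+-monoˡ-≤ N (theta-monoˡ m (suc i) c≤d)) (theta-≤ i i<j)))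
      (F-minus-≥ n N _ true const (theta-≤ i i<j))
    ... | inj₂ j≤i = cong₂ _xor_ (F-minus-< (n<theta i j≤i))
      (F-minus-< (ℕ.<-≤-trans (n<theta i j≤i) (theta-monoˡ m (suc i) c≤d)))
    total : F (+ n) xor xsum (proj₁ (rel n m∤n)) (λ i → F (+ n - + theta c m (suc i)) xor F (+ n - + theta d m (suc i))) ≡ true
    total = cong₂ _xor_
      (const n (ℕ.≤-trans N≤mN+1 (ℕ.m≤n+m _ (theta d m j))) (ℕ.m≤n+m (suc n) N))
      (xsum-false (proj₁ (rel n m∤n)) (λ i _ → pair i))

  -- At n equal to an exponent, the sum contains `F (+ 0)`. Its partner has a negative argument
  -- because c < d, and all other terms are false if `F` is false throughout the window.
  infinitely-often-true : c < d → F (+ 0) ≡ true → ∀ N → ∃[ n ] N ≤ n × F (+ n) ≡ true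
  infinitely-often-true c<d F0 N with search (λ x → F (+ x)) N (suc (theta c m (suc (m ℕ.* N))))
  ... | inj₁ found = found
  ... | inj₂ const = contradiction (trans (sym total) (proj₂ (proj₂ (rel n m∤n)))) (λ ())
    where
    -- The index `suc j` is 1 modulo m, so n is congruent to c, which lies strictly between 0 and m.
    -- The gap before n is at least j + 1 and hence at least N.
    j = m ℕ.* N
    n = theta c m (suc j)
    N≤1+j : N ≤ suc j
    N≤1+j = ℕ.m≤n⇒m≤1+n (ℕ.m≤n*m N m {{ℕ.>-nonZero (ℕ.<⇒≤ 1<m)}})
    j<n : j < n
    j<n = ℕ.≤-trans (ℕ.m≤n*m (suc j) c {{ℕ.>-nonZero 1≤c}}) (ℕ.m≤m+n _ (m ℕ.* choose2 (suc j)))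
    m∤n : ¬ m ∣ n
    m∤n m∣n = ℕ.<⇒≱ (subst (c <_) (sym m≡c+d) (ℕ.m<m+n c (ℕ.≤-trans 1≤c c≤d)))
      (∣.∣⇒≤ {{ℕ.>-nonZero 1≤c}} (∣.∣m+n∣m⇒∣n
        (subst (m ∣_) (trans (cong (ℕ._+ m ℕ.* choose2 (suc j)) (trans (ℕ.*-suc c j) (ℕ.+-comm c (c ℕ.* j))))
          (trans (ℕ.+-assoc (c ℕ.* j) c _) (trans (cong (c ℕ.* j ℕ.+_) (ℕ.+-comm c _)) (sym (ℕ.+-assoc (c ℕ.* j) _ c))))) m∣n)
        (∣.∣m∣n⇒∣m+n (∣.∣n⇒∣m*n c (∣.m∣m*n N)) (∣.m∣m*n (choose2 (suc j))))))
    theta-≤ : ∀ i → i < j → theta d m (suc i) ℕ.+ N ≤ n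
    theta-≤ i i<j = ℕ.≤-trans (ℕ.+-mono-≤ (theta-mono d m i<j) N≤1+j) (theta-gap j)
    pair : ∀ i → ¬ i ≡ j → F (+ n - + theta c m (suc i)) xor F (+ n - + theta d m (suc i)) ≡ false
    pair i i≢j with ℕ.<-cmp i j
    ... | tri< i<j _ _ = cong₂ _xor_
      (F-minus-≥ n N _ false const (ℕ.≤-trans (ℕ.+-monoˡ-≤ N (theta-monoˡ m (suc i) c≤d)) (theta-≤ i i<j)))
      (F-minus-≥ n N _ false const (theta-≤ i i<j))
    ... | tri≈ _ i≡j _ = contradiction i≡j i≢j
    ... | tri> _ _ j<i = cong₂ _xor_ (F-minus-< n<theta)
      (F-minus-< (ℕ.<-≤-trans n<theta (theta-monoˡ m (suc i) c≤d)))
      where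
      n<theta : n < theta c m (suc i)
      n<theta = ℕ.<-≤-trans (ℕ.+-mono-<-≤ (ℕ.*-monoʳ-< c {{ℕ.>-nonZero 1≤c}} (s≤s j<i))
                              (ℕ.*-monoʳ-≤ m (choose2-mono (s≤s (ℕ.<⇒≤ j<i))))) ℕ.≤-refl
    total : F (+ n) xor xsum (proj₁ (rel n m∤n)) (λ i → F (+ n - + theta c m (suc i)) xor F (+ n - + theta d m (suc i))) ≡ true
    total = cong₂ _xor_
      (const n (ℕ.≤-trans N≤1+j j<n) (ℕ.m≤n+m (suc n) N))
      (trans (xsum-single (proj₁ (rel n m∤n)) j (ℕ.<-≤-trans j<n (proj₁ (proj₂ (rel n m∤n)))) (λ i _ → pair i))
        (cong₂ _xor_ (trans (cong F (ℤ.+-inverseʳ (+ n))) F0)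
          (F-minus-< (ℕ.+-monoˡ-< (m ℕ.* choose2 (suc j)) (ℕ.*-monoˡ-< (suc j) c<d)))))

infinitely-often-odd-symmetric : ∀ {a m} → 1 ≤ a → m ≡ a ℕ.+ a → ∀ N → ∃[ n ] N ≤ n × cpParity a a m (+ n) ≡ true
infinitely-often-odd-symmetric {a} {m} 1≤a m≡a+a N = n , N≤n , (begin
  cpParity a a m (+ n)
    ≡⟨ cpParity-double 1≤a m≡a+a p R ℕ.≤-refl ⟩
  xsum R (λ r → u P r (+ m * (+ p - + choose2 (suc r))))
    ≡⟨ xsum-cong R (λ r _ → cong (λ z → u P r (+ m * z)) (arith (+ p) (+ choose2 (suc r)) (+ r))) ⟩
  w P 1≤m R 0 (+ p)
    ≡⟨ w-e P 1≤m p 0 R (+ p) p<R ℤ.≤-refl ⟩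
  e 0 p (+ p)
    ≡⟨ e-pentagonal N ⟩
  true ∎)
  where
  open ≡-Reasoning
  1≤m : 1 ≤ m
  1≤m = subst (1 ≤_) (sym m≡a+a) (ℕ.≤-trans 1≤a (ℕ.m≤m+n a a))
  P = partSeries a m 1≤a (subst (a ≤_) (sym m≡a+a) (ℕ.m≤m+n a a))
  p = pent⁻ (suc N)
  n = m ℕ.* p ℕ.+ m ℕ.* p
  R = suc n
  p≤n : p ≤ n
  p≤n = ℕ.≤-trans (ℕ.m≤n*m p m {{ℕ.>-nonZero 1≤m}}) (ℕ.m≤m+n _ (m ℕ.* p))
  p<R : p < R
  p<R = s≤s p≤n
  N≤n : N ≤ n
  N≤n = ℕ.≤-trans (ℕ.≤-trans (ℕ.n≤1+n N) (ℕ.≤-trans (ℕ.m≤m*n (suc N) (suc N)) (ℕ.m≤m+n _ (choose2 (suc N))))) p≤n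
  arith : ∀ p t r → p - t ≡ p - t - r * + 0
  arith = solve-∀

infinitely-often-even-odd : ∀ {a b m} → m ≡ a ℕ.+ b → 1 ≤ a → 1 ≤ b →
  ((N : ℕ) → ∃[ n ] N ≤ n × cpParity a b m (+ n) ≡ false)
  × ((N : ℕ) → ∃[ n ] N ≤ n × cpParity a b m (+ n) ≡ true)
infinitely-often-even-odd {a} {b} {m} m≡a+b 1≤a 1≤b with ℕ.<-cmp a b
... | tri< a<b _ _ =
  infinitely-often-false m≡a+b 1≤a (ℕ.<⇒≤ a<b) F (λ _ → refl) rel ,
  infinitely-often-true m≡a+b 1≤a (ℕ.<⇒≤ a<b) F (λ _ → refl) rel a<b refl
  where
  F = cpParity a b m
  rel = cp-ThetaRelation m≡a+b 1≤a 1≤b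
... | tri≈ _ refl _ =
  infinitely-often-false m≡a+b 1≤a ℕ.≤-refl F (λ _ → refl) (cp-ThetaRelation m≡a+b 1≤a 1≤b) ,
  infinitely-often-odd-symmetric 1≤a m≡a+b
  where F = cpParity a b m
... | tri> _ _ b<a =
  infinitely-often-false m≡b+a 1≤b (ℕ.<⇒≤ b<a) F (λ _ → refl) rel ,
  infinitely-often-true m≡b+a 1≤b (ℕ.<⇒≤ b<a) F (λ _ → refl) rel b<a refl
  where
  F = cpParity a b m
  m≡b+a = trans m≡a+b (ℕ.+-comm a b)
  -- Only the two families of exponents change places; `F` remains the parity of `cp a b m`.
  rel = ThetaRelation-sym {a} {b} {m} {F} (cp-ThetaRelation m≡a+b 1≤a 1≤b)

theorem4p1 : (a m : ℕ) → 1 ≤ a → a ≤ m ∸ 1 →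
    ((N : ℕ) → ∃[ n ] (N ≤ n × 2 ∣ cp a (m ∸ a) m n))
    × ((N : ℕ) → ∃[ n ] (N ≤ n × ¬ (2 ∣ cp a (m ∸ a) m n)))
theorem4p1 a m 1≤a a≤m-1 =
  (λ N → let (n , N≤n , even) = proj₁ parities N in n , N≤n , parity-false⇒2∣ (cp a (m ∸ a) m n) even) ,
  (λ N → let (n , N≤n , odd) = proj₂ parities N in n , N≤n , parity-true⇒2∤ (cp a (m ∸ a) m n) odd)
  where
  -- Truncated subtraction turns the hypothesis at m = 0 into a ≤ 0, which 1 ≤ a excludes.
  suc-≤ : ∀ m → a ≤ m ∸ 1 → a < m
  suc-≤ zero    a≤0 = contradiction (ℕ.≤-trans 1≤a a≤0) (λ ())
  suc-≤ (suc m) a≤m = s≤s a≤m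
  a<m : a < m
  a<m = suc-≤ m a≤m-1
  parities = infinitely-often-even-odd {a} {m ∸ a} {m} (sym (ℕ.m+[n∸m]≡n (ℕ.<⇒≤ a<m))) 1≤a (ℕ.m<n⇒0<n∸m a<m)
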